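{- For every integer $r\ge 0$, every integer $p>0$, and every $x$ with $|x|<1$, $$\sum_{n=0}^{\infty} n^p\left(\frac{1}{(1-x)^{r+1}}-1-\binom{r+1}{1}x-\binom{r+2}{2}x^2-\dots-\binom{r+n}{n}x^n\right)$$ $$=\frac{1}{r!}\left(\frac{d}{dx}\right)^r\left(\frac{x^r}{(1-x)^2}\,\omega_p\!\left(\frac{x}{1-x}\right)\right)-\frac{1}{(1-x)^{r+1}}\,\omega_{p,r+1}\!\left(\frac{x}{1-x}\right).$$
   Context: $S(n,k)$ denotes the Stirling numbers of the second kind. The geometric polynomials are $\omega_n(x)=\sum_{k=0}^{n}S(n,k)\,k!\,x^k$ for integers $n\ge 0$. The generalized geometric polynomials are $\omega_{n,r+1}(x)=\frac{1}{r!}\sum_{k=0}^{n}S(n,k)\,(k+r)!\,x^k$ for integers $n\ge 0$, $r\ge 0$. Here $x$ is a real or complex number. -}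

module Defs where

open import Algebra.Bundles using (RawRing)
import Algebra.Definitions.RawSemiring as RawSemiringDefs
open import Data.Bool using (if_then_else_)
open import Data.Fin using (toℕ)
open import Data.Integer as ℤ using (+_; -[1+_])
import Data.Integer.Properties as ℤₚ
open import Data.Nat as ℕ using (ℕ; zero; suc; _!)
import Data.Nat.Properties as ℕₚ
open import Data.Product using (∃-syntax; Σ-syntax; _×_; _,_; proj₁; proj₂)
open import Data.Rational
open import Data.Rational.Properties
open import Data.Rational.Solver using (module +-*-Solver)
import Data.Rational.Unnormalised as ℚᵘ
import Data.Rational.Unnormalised.Properties as ℚᵘₚ
open import Data.Sum using (inj₁; inj₂)
open import Level using (0ℓ)
open import Relation.Binary.PropositionalEquality
open import Relation.Nullary using (Dec; does; yes; no; contradiction)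

open +-*-Solver using (solve; _:=_; _:+_; _:*_; :-_; con)

-- Opaque only so that type checking does not normalise symbolic fractions.
opaque

  fromℕ : ℕ → ℚ
  fromℕ n = + n / 1

  unit : ℕ → ℚ
  unit n = + 1 / suc n

opaque
  unfolding fromℕ unit

  fromℕ-def : ∀ n → fromℕ n ≡ + n / 1
  fromℕ-def n = refl

  unit-def : ∀ n → unit n ≡ + 1 / suc n
  unit-def n = refl

  fromℕ-suc : ∀ k → fromℕ (suc k) ≡ fromℕ k + 1ℚ
  fromℕ-suc k = toℚᵘ-injective (begin
    toℚᵘ (fromℕ (suc k))                      ≈⟨ toℚᵘ-fromℚᵘ (ℚᵘ.mkℚᵘ (+ suc k) 0) ⟩
    ℚᵘ.mkℚᵘ (+ suc k) 0                       ≈⟨ ℚᵘ.*≡* (cong (ℤ._* (+ 1)) lemma) ⟩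
    ℚᵘ.mkℚᵘ (+ k) 0 ℚᵘ.+ ℚᵘ.1ℚᵘ               ≈⟨ ℚᵘₚ.+-congˡ ℚᵘ.1ℚᵘ (ℚᵘₚ.≃-sym (toℚᵘ-fromℚᵘ (ℚᵘ.mkℚᵘ (+ k) 0))) ⟩
    toℚᵘ (fromℕ k) ℚᵘ.+ toℚᵘ 1ℚ               ≈⟨ ℚᵘₚ.≃-sym (toℚᵘ-homo-+ (fromℕ k) 1ℚ) ⟩
    toℚᵘ (fromℕ k + 1ℚ)                       ∎)
    where
    open ℚᵘₚ.≃-Reasoning
    lemma : + suc k ≡ (+ k) ℤ.* (+ 1) ℤ.+ (+ 1) ℤ.* (+ 1)
    lemma = trans (cong +_ (ℕₚ.+-comm 1 k)) (cong (ℤ._+ (+ 1)) (sym (ℤₚ.*-identityʳ (+ k))))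

  fromℕ-nonNeg : ∀ k → 0ℚ ≤ fromℕ k
  fromℕ-nonNeg k = nonNegative⁻¹ (fromℕ k) {{normalize-nonNeg k 1}}

  unit-pos : ∀ n → 0ℚ < unit n
  unit-pos n = positive⁻¹ (unit n) {{normalize-pos 1 (suc n)}}

  unit-inverse : ∀ n → fromℕ (suc n) * unit n ≡ 1ℚ
  unit-inverse n = toℚᵘ-injective (begin
    toℚᵘ (fromℕ (suc n) * unit n)             ≈⟨ toℚᵘ-homo-* (fromℕ (suc n)) (unit n) ⟩
    toℚᵘ (fromℕ (suc n)) ℚᵘ.* toℚᵘ (unit n)   ≈⟨ ℚᵘₚ.*-cong (toℚᵘ-fromℚᵘ (ℚᵘ.mkℚᵘ (+ suc n) 0)) (toℚᵘ-fromℚᵘ (ℚᵘ.mkℚᵘ (+ 1) n)) ⟩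
    ℚᵘ.mkℚᵘ (+ suc n) 0 ℚᵘ.* ℚᵘ.mkℚᵘ (+ 1) n  ≈⟨ ℚᵘ.*≡* (trans (ℤₚ.*-identityʳ _) (trans (ℤₚ.*-identityʳ (+ suc n)) (sym (trans (ℤₚ.*-identityˡ _) (cong +_ (ℕₚ.*-identityˡ (suc n))))))) ⟩
    ℚᵘ.1ℚᵘ                                    ∎)
    where open ℚᵘₚ.≃-Reasoning

  unit-anti : ∀ {m n} → m ℕ.≤ n → unit n ≤ unit m
  unit-anti {m} {n} m≤n = toℚᵘ-cancel-≤ (ℚᵘₚ.≤-respˡ-≃ (ℚᵘₚ.≃-sym (toℚᵘ-fromℚᵘ (ℚᵘ.mkℚᵘ (+ 1) n)))
    (ℚᵘₚ.≤-respʳ-≃ (ℚᵘₚ.≃-sym (toℚᵘ-fromℚᵘ (ℚᵘ.mkℚᵘ (+ 1) m)))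
      (ℚᵘ.*≤* (ℤₚ.*-monoˡ-≤-nonNeg (+ 1) (ℤ.+≤+ (ℕ.s≤s m≤n))))))

  archimedean : ∀ ε → 0ℚ < ε → ∃[ N ] (∀ n → N ℕ.≤ n → unit n ≤ ε)
  archimedean ε@(mkℚ (+ 0) d c)     0<ε with record { pos = () } ← positive 0<ε
  archimedean ε@(mkℚ -[1+ p ] d c)  0<ε with record { pos = () } ← positive 0<ε
  archimedean ε@(mkℚ (+ suc p) d c) 0<ε = d , λ n d≤n → ≤-trans (unit-anti d≤n)
    (toℚᵘ-cancel-≤ (ℚᵘₚ.≤-respˡ-≃ (ℚᵘₚ.≃-sym (toℚᵘ-fromℚᵘ (ℚᵘ.mkℚᵘ (+ 1) d)))
      (ℚᵘ.*≤* (ℤₚ.*-monoʳ-≤-nonNeg (+ suc d) {+ 1} {+ suc p} (ℤ.+≤+ (ℕ.s≤s ℕ.z≤n))))))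

  fromℕ-zero : fromℕ 0 ≡ 0ℚ
  fromℕ-zero = refl

  p≤∣↥p∣ : ∀ p → p ≤ fromℕ ℤ.∣ ↥ p ∣
  p≤∣↥p∣ p@(mkℚ (+ n) d c) = toℚᵘ-cancel-≤
    (ℚᵘₚ.≤-respʳ-≃ (ℚᵘₚ.≃-sym (toℚᵘ-fromℚᵘ (ℚᵘ.mkℚᵘ (+ n) 0)))
      (ℚᵘ.*≤* (ℤₚ.*-monoˡ-≤-nonNeg (+ n) (ℤ.+≤+ (ℕ.s≤s ℕ.z≤n)))))
  p≤∣↥p∣ p@(mkℚ -[1+ n ] d c) = ≤-trans (<⇒≤ (negative⁻¹ p)) (fromℕ-nonNeg (suc n))

opaque

  +-nonNeg : ∀ {p q} → 0ℚ ≤ p → 0ℚ ≤ q → 0ℚ ≤ p + q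
  +-nonNeg = +-mono-≤ {0ℚ} {_} {0ℚ}

  *-nonNeg : ∀ {p q} → 0ℚ ≤ p → 0ℚ ≤ q → 0ℚ ≤ p * q
  *-nonNeg {p} {q} 0≤p 0≤q = nonNegative⁻¹ (p * q) {{nonNeg*nonNeg⇒nonNeg p {{nonNegative 0≤p}} q {{nonNegative 0≤q}}}}

  *-pos : ∀ {p q} → 0ℚ < p → 0ℚ < q → 0ℚ < p * q
  *-pos {p} {q} 0<p 0<q = positive⁻¹ (p * q) {{pos*pos⇒pos p {{positive 0<p}} q {{positive 0<q}}}}

  *-mono-≤ : ∀ {p q r s} → 0ℚ ≤ p → 0ℚ ≤ s → p ≤ q → r ≤ s → p * r ≤ q * s
  *-mono-≤ {p} {q} {r} {s} 0≤p 0≤s p≤q r≤s = ≤-trans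
    (*-monoˡ-≤-nonNeg p {{nonNegative 0≤p}} r≤s) (*-monoʳ-≤-nonNeg s {{nonNegative 0≤s}} p≤q)

  square-mono-≤ : ∀ {p q} → 0ℚ ≤ p → p ≤ q → p * p ≤ q * q
  square-mono-≤ 0≤p p≤q = *-mono-≤ 0≤p (≤-trans 0≤p p≤q) p≤q p≤q

  square-nonNeg : ∀ p → 0ℚ ≤ p * p
  square-nonNeg p with ≤-total 0ℚ p
  ... | inj₁ 0≤p = *-nonNeg 0≤p 0≤p
  ... | inj₂ p≤0 = subst (0ℚ ≤_) (solve 1 (λ x → (:- x) :* (:- x) := x :* x) refl p)
                         (*-nonNeg (neg-antimono-≤ p≤0) (neg-antimono-≤ p≤0))

  half-pos : ∀ {ε} → 0ℚ < ε → 0ℚ < ½ * ε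
  half-pos = *-pos (positive⁻¹ ½)

  half+half : ∀ ε → ½ * ε + ½ * ε ≡ ε
  half+half ε = trans (sym (*-distribʳ-+ ε ½ ½)) (*-identityˡ ε)

  p≤p+q : ∀ p {q} → 0ℚ ≤ q → p ≤ p + q
  p≤p+q p 0≤q = subst (_≤ p + _) (+-identityʳ p) (+-monoʳ-≤ p 0≤q)

  p≤∣p∣ : ∀ p → p ≤ ∣ p ∣
  p≤∣p∣ p with ≤-total 0ℚ p
  ... | inj₁ 0≤p = ≤-reflexive (sym (0≤p⇒∣p∣≡p 0≤p))
  ... | inj₂ p≤0 = ≤-trans p≤0 (0≤∣p∣ p)

  ∣p-q∣-sym : ∀ p q → ∣ p - q ∣ ≡ ∣ q - p ∣
  ∣p-q∣-sym p q = trans (sym (∣-p∣≡∣p∣ (p - q)))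
    (cong ∣_∣ (solve 2 (λ x y → :- (x :+ :- y) := y :+ :- x) refl p q))

  ∣p∣≤∣q∣+∣p-q∣ : ∀ p q → ∣ p ∣ ≤ ∣ q ∣ + ∣ p - q ∣
  ∣p∣≤∣q∣+∣p-q∣ p q = subst (λ z → ∣ z ∣ ≤ ∣ q ∣ + ∣ p - q ∣)
    (solve 2 (λ x y → y :+ (x :+ :- y) := x) refl p q) (∣p+q∣≤∣p∣+∣q∣ q (p - q))

  ∣p-q∣<ε : ∀ {p q ε} → p < q + ε → q < p + ε → ∣ p - q ∣ < ε
  ∣p-q∣<ε {p} {q} {ε} p<q+ε q<p+ε with ∣p∣≡p∨∣p∣≡-p (p - q)
  ... | inj₁ eq = subst₂ _<_ (sym eq)
          (solve 2 (λ y e → (y :+ e) :+ :- y := e) refl q ε) (+-monoˡ-< (- q) p<q+ε)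
  ... | inj₂ eq = subst₂ _<_ (trans (solve 2 (λ x y → y :+ :- x := :- (x :+ :- y)) refl p q) (sym eq))
          (solve 2 (λ x e → (x :+ e) :+ :- x := e) refl p ε) (+-monoˡ-< (- p) q<p+ε)

-- Total on representing sequences, whose terms may be 0 even when the limit is not;
-- the value at 0 is junk.
recip : ℚ → ℚ
recip p with p ≟ 0ℚ
... | yes _   = 0ℚ
... | no  p≢0 = 1/_ p {{≢-nonZero p≢0}}

opaque

  recip-inverse : ∀ {p} → 0ℚ < p → recip p * p ≡ 1ℚ
  recip-inverse {p} 0<p with p ≟ 0ℚ
  ... | yes p≡0 = contradiction (sym p≡0) (<⇒≢ 0<p)
  ... | no  p≢0 = *-inverseˡ p {{≢-nonZero p≢0}}

  recip-pos : ∀ {p} → 0ℚ < p → 0ℚ < recip p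
  recip-pos {p} 0<p = *-cancelʳ-<-nonNeg p {{nonNegative (<⇒≤ 0<p)}}
    (subst₂ _<_ (sym (*-zeroˡ p)) (sym (recip-inverse 0<p)) (positive⁻¹ 1ℚ))

  recip-anti : ∀ {p q} → 0ℚ < p → p ≤ q → recip q ≤ recip p
  recip-anti {p} {q} 0<p p≤q = *-cancelʳ-≤-pos p {{positive 0<p}} (≤-trans
    (*-monoˡ-≤-nonNeg (recip q) {{nonNegative (<⇒≤ (recip-pos 0<q))}} p≤q)
    (≤-reflexive (trans (recip-inverse 0<q) (sym (recip-inverse 0<p)))))
    where
    0<q : 0ℚ < q
    0<q = <-≤-trans 0<p p≤q

-- The largest k ≤ bound with k² ≤ a (for a ≥ 0).
floorSqrtUpTo : ℕ → ℚ → ℕ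
floorSqrtUpTo zero    a = 0
floorSqrtUpTo (suc k) a =
  if does (fromℕ (suc k) * fromℕ (suc k) ≤? a) then suc k else floorSqrtUpTo k a

floorSqrt : ℚ → ℕ
floorSqrt a = floorSqrtUpTo ℤ.∣ ↥ a ∣ a

-- ⌊ √(∣ q ∣ (n+1)²) ⌋ / (n+1), which is within 1/(n+1) of √∣ q ∣.
sqrtApprox : ℕ → ℚ → ℚ
sqrtApprox n q = fromℕ (floorSqrt (∣ q ∣ * (fromℕ (suc n) * fromℕ (suc n)))) * unit n

opaque

  floorSqrtUpTo-lower : ∀ k {a} → 0ℚ ≤ a →
    fromℕ (floorSqrtUpTo k a) * fromℕ (floorSqrtUpTo k a) ≤ a
  floorSqrtUpTo-lower zero    {a} 0≤a = subst (λ z → z * z ≤ a) (sym fromℕ-zero) 0≤a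
  floorSqrtUpTo-lower (suc k) {a} 0≤a = by (fromℕ (suc k) * fromℕ (suc k) ≤? a)
    where
    by : (d : Dec (fromℕ (suc k) * fromℕ (suc k) ≤ a)) →
      let m = if does d then suc k else floorSqrtUpTo k a in fromℕ m * fromℕ m ≤ a
    by (yes le) = le
    by (no  _ ) = floorSqrtUpTo-lower k 0≤a

  floorSqrtUpTo-upper : ∀ k {a} → a < fromℕ (suc k) * fromℕ (suc k) →
    a < fromℕ (suc (floorSqrtUpTo k a)) * fromℕ (suc (floorSqrtUpTo k a))
  floorSqrtUpTo-upper zero        lt = lt
  floorSqrtUpTo-upper (suc k) {a} lt = by (fromℕ (suc k) * fromℕ (suc k) ≤? a)
    where
    by : (d : Dec (fromℕ (suc k) * fromℕ (suc k) ≤ a)) →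
      let m = if does d then suc k else floorSqrtUpTo k a in a < fromℕ (suc m) * fromℕ (suc m)
    by (yes _  ) = lt
    by (no  nle) = floorSqrtUpTo-upper k (≰⇒> nle)

  floorSqrt-upper : ∀ {a} → 0ℚ ≤ a → a < fromℕ (suc (floorSqrt a)) * fromℕ (suc (floorSqrt a))
  floorSqrt-upper {a} 0≤a = floorSqrtUpTo-upper F (≤-<-trans (p≤∣↥p∣ a) (begin-strict
    fromℕ F                           ≡⟨ +-identityʳ (fromℕ F) ⟨
    fromℕ F + 0ℚ                      <⟨ +-monoʳ-< (fromℕ F) (positive⁻¹ 1ℚ) ⟩
    fromℕ F + 1ℚ                      ≡⟨ fromℕ-suc F ⟨
    fromℕ (suc F)                     ≡⟨ *-identityʳ (fromℕ (suc F)) ⟨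
    fromℕ (suc F) * 1ℚ                ≤⟨ *-monoˡ-≤-nonNeg (fromℕ (suc F)) {{nonNegative (fromℕ-nonNeg (suc F))}} 1≤ ⟩
    fromℕ (suc F) * fromℕ (suc F)     ∎))
    where
    open ≤-Reasoning
    F : ℕ
    F = ℤ.∣ ↥ a ∣
    1≤ : 1ℚ ≤ fromℕ (suc F)
    1≤ = subst (1ℚ ≤_) (trans (+-comm 1ℚ (fromℕ F)) (sym (fromℕ-suc F))) (p≤p+q 1ℚ (fromℕ-nonNeg F))

  sqrtApprox-nonNeg : ∀ n q → 0ℚ ≤ sqrtApprox n q
  sqrtApprox-nonNeg n q = *-nonNeg (fromℕ-nonNeg (floorSqrt (∣ q ∣ * (fromℕ (suc n) * fromℕ (suc n))))) (<⇒≤ (unit-pos n))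

  private
    rescale : ∀ n q → let D = fromℕ (suc n) ; E = unit n in (q * (D * D)) * (E * E) ≡ q
    rescale n q = begin
      (q * (D * D)) * (E * E)   ≡⟨ solve 3 (λ x d e → (x :* (d :* d)) :* (e :* e) := x :* ((d :* e) :* (d :* e))) refl q D E ⟩
      q * ((D * E) * (D * E))   ≡⟨ cong (λ z → q * (z * z)) (unit-inverse n) ⟩
      q * (1ℚ * 1ℚ)             ≡⟨ *-identityʳ q ⟩
      q                         ∎
      where
      open ≡-Reasoning
      D : ℚ
      D = fromℕ (suc n)
      E : ℚ
      E = unit n

  sqrtApprox-lower : ∀ n q → sqrtApprox n q * sqrtApprox n q ≤ ∣ q ∣
  sqrtApprox-lower n q = begin
    (K * E) * (K * E)                ≡⟨ solve 2 (λ k e → (k :* e) :* (k :* e) := (k :* k) :* (e :* e)) refl K E ⟩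
    (K * K) * (E * E)                ≤⟨ *-monoʳ-≤-nonNeg (E * E) {{nonNegative (square-nonNeg E)}}
                                          (floorSqrtUpTo-lower ℤ.∣ ↥ A ∣ (*-nonNeg (0≤∣p∣ q) (square-nonNeg D))) ⟩
    (∣ q ∣ * (D * D)) * (E * E)      ≡⟨ rescale n ∣ q ∣ ⟩
    ∣ q ∣                            ∎
    where
    open ≤-Reasoning
    D : ℚ
    D = fromℕ (suc n)
    E : ℚ
    E = unit n
    A : ℚ
    A = ∣ q ∣ * (D * D)
    K : ℚ
    K = fromℕ (floorSqrt A)

  sqrtApprox-upper : ∀ n q → ∣ q ∣ < (sqrtApprox n q + unit n) * (sqrtApprox n q + unit n)
  sqrtApprox-upper n q = begin-strict
    ∣ q ∣                              ≡⟨ rescale n ∣ q ∣ ⟨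
    (∣ q ∣ * (D * D)) * (E * E)        <⟨ *-monoˡ-<-pos (E * E) {{positive (*-pos (unit-pos n) (unit-pos n))}}
                                            (floorSqrt-upper (*-nonNeg (0≤∣p∣ q) (square-nonNeg D))) ⟩
    (K′ * K′) * (E * E)                ≡⟨ cong (λ z → (z * z) * (E * E)) (fromℕ-suc (floorSqrt A)) ⟩
    ((K + 1ℚ) * (K + 1ℚ)) * (E * E)    ≡⟨ solve 2 (λ k e → ((k :+ con 1ℚ) :* (k :+ con 1ℚ)) :* (e :* e) := (k :* e :+ e) :* (k :* e :+ e)) refl K E ⟩
    (K * E + E) * (K * E + E)          ∎
    where
    open ≤-Reasoning
    D : ℚ
    D = fromℕ (suc n)
    E : ℚ
    E = unit n
    A : ℚ
    A = ∣ q ∣ * (D * D)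
    K : ℚ
    K = fromℕ (floorSqrt A)
    K′ : ℚ
    K′ = fromℕ (suc (floorSqrt A))

IsCauchy : (ℕ → ℚ) → Set
IsCauchy a = ∀ ε → 0ℚ < ε → ∃[ N ] (∀ m n → N ℕ.≤ m → N ℕ.≤ n → ∣ a m - a n ∣ < ε)

-- Real numbers as Cauchy sequences of rationals, taken up to _≈ᴿ_.
record ℝ : Set where
  constructor mkℝ
  field
    seq    : ℕ → ℚ
    cauchy : IsCauchy seq

open ℝ public

infix 4 _≈ᴿ_ _<ᴿ_

_≈ᴿ_ : ℝ → ℝ → Set
x ≈ᴿ y = ∀ ε → 0ℚ < ε → ∃[ N ] (∀ n → N ℕ.≤ n → ∣ seq x n - seq y n ∣ < ε)

_<ᴿ_ : ℝ → ℝ → Set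
x <ᴿ y = Σ[ q ∈ ℚ ] 0ℚ < q × ∃[ N ] (∀ n → N ℕ.≤ n → seq x n + q ≤ seq y n)

opaque

  const-cauchy : ∀ q → IsCauchy (λ _ → q)
  const-cauchy q ε 0<ε = 0 , λ _ _ _ _ → subst (_< ε) (sym (cong ∣_∣ (+-inverseʳ q))) 0<ε

  +-cauchy : ∀ a b → IsCauchy a → IsCauchy b → IsCauchy (λ n → a n + b n)
  +-cauchy a b ca cb ε 0<ε =
    let N₁ , A = ca (½ * ε) (half-pos 0<ε)
        N₂ , B = cb (½ * ε) (half-pos 0<ε)
    in N₁ ℕ.⊔ N₂ , λ m n N≤m N≤n → begin-strict
    ∣ (a m + b m) - (a n + b n) ∣         ≡⟨ cong ∣_∣ (solve 4 (λ p q r s → (p :+ q) :+ :- (r :+ s) := (p :+ :- r) :+ (q :+ :- s)) refl (a m) (b m) (a n) (b n)) ⟩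
    ∣ (a m - a n) + (b m - b n) ∣         ≤⟨ ∣p+q∣≤∣p∣+∣q∣ (a m - a n) (b m - b n) ⟩
    ∣ a m - a n ∣ + ∣ b m - b n ∣         <⟨ +-mono-<
      (A m n (ℕₚ.m⊔n≤o⇒m≤o N₁ N₂ N≤m) (ℕₚ.m⊔n≤o⇒m≤o N₁ N₂ N≤n))
      (B m n (ℕₚ.m⊔n≤o⇒n≤o N₁ N₂ N≤m) (ℕₚ.m⊔n≤o⇒n≤o N₁ N₂ N≤n)) ⟩
    ½ * ε + ½ * ε                         ≡⟨ half+half ε ⟩
    ε                                     ∎
    where
    open ≤-Reasoning

  neg-cauchy : ∀ a → IsCauchy a → IsCauchy (λ n → - a n)
  neg-cauchy a ca ε 0<ε = proj₁ (ca ε 0<ε) , λ m n N≤m N≤n → subst (_< ε)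
    (trans (∣p-q∣-sym (a m) (a n)) (cong ∣_∣ (solve 2 (λ p q → q :+ :- p := :- p :+ :- (:- q)) refl (a m) (a n))))
    (proj₂ (ca ε 0<ε) m n N≤m N≤n)

  cauchy-bounded : ∀ a → IsCauchy a →
    Σ[ B ∈ ℚ ] 0ℚ < B × ∃[ N ] (∀ n → N ℕ.≤ n → ∣ a n ∣ ≤ B)
  cauchy-bounded a ca =
    let N , C = ca 1ℚ (positive⁻¹ 1ℚ) in
    ∣ a N ∣ + 1ℚ , +-mono-≤-< (0≤∣p∣ (a N)) (positive⁻¹ 1ℚ) , N , λ n N≤n →
    ≤-trans (∣p∣≤∣q∣+∣p-q∣ (a n) (a N)) (+-monoʳ-≤ ∣ a N ∣ (<⇒≤ (C n N N≤n ℕₚ.≤-refl)))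

  *-cauchy : ∀ a b → IsCauchy a → IsCauchy b → IsCauchy (λ n → a n * b n)
  *-cauchy a b ca cb ε 0<ε with cauchy-bounded a ca | cauchy-bounded b cb
  ... | A , 0<A , M₁ , ∣a∣≤A | B , 0<B , M₂ , ∣b∣≤B =
    let N₁ , Ca = ca (recip B * (½ * ε)) (*-pos (recip-pos 0<B) (half-pos 0<ε))
        N₂ , Cb = cb (recip A * (½ * ε)) (*-pos (recip-pos 0<A) (half-pos 0<ε))
    in (M₁ ℕ.⊔ M₂) ℕ.⊔ (N₁ ℕ.⊔ N₂) , λ m n N≤m N≤n →
    let M≤m  = ℕₚ.m⊔n≤o⇒m≤o (M₁ ℕ.⊔ M₂) (N₁ ℕ.⊔ N₂) N≤m
        M≤n  = ℕₚ.m⊔n≤o⇒m≤o (M₁ ℕ.⊔ M₂) (N₁ ℕ.⊔ N₂) N≤n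
        N≤m′ = ℕₚ.m⊔n≤o⇒n≤o (M₁ ℕ.⊔ M₂) (N₁ ℕ.⊔ N₂) N≤m
        N≤n′ = ℕₚ.m⊔n≤o⇒n≤o (M₁ ℕ.⊔ M₂) (N₁ ℕ.⊔ N₂) N≤n
    in begin-strict
    ∣ a m * b m - a n * b n ∣
      ≡⟨ cong ∣_∣ (solve 4 (λ p q r s → p :* q :+ :- (r :* s) := p :* (q :+ :- s) :+ s :* (p :+ :- r)) refl (a m) (b m) (a n) (b n)) ⟩
    ∣ a m * (b m - b n) + b n * (a m - a n) ∣
      ≤⟨ ∣p+q∣≤∣p∣+∣q∣ (a m * (b m - b n)) (b n * (a m - a n)) ⟩
    ∣ a m * (b m - b n) ∣ + ∣ b n * (a m - a n) ∣
      ≡⟨ cong₂ _+_ (∣p*q∣≡∣p∣*∣q∣ (a m) (b m - b n)) (∣p*q∣≡∣p∣*∣q∣ (b n) (a m - a n)) ⟩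
    ∣ a m ∣ * ∣ b m - b n ∣ + ∣ b n ∣ * ∣ a m - a n ∣
      ≤⟨ +-mono-≤ (*-monoʳ-≤-nonNeg ∣ b m - b n ∣ {{∣-∣-nonNeg (b m - b n)}} (∣a∣≤A m (ℕₚ.m⊔n≤o⇒m≤o M₁ M₂ M≤m)))
                  (*-monoʳ-≤-nonNeg ∣ a m - a n ∣ {{∣-∣-nonNeg (a m - a n)}} (∣b∣≤B n (ℕₚ.m⊔n≤o⇒n≤o M₁ M₂ M≤n))) ⟩
    A * ∣ b m - b n ∣ + B * ∣ a m - a n ∣
      <⟨ +-mono-< (*-monoʳ-<-pos A {{positive 0<A}} (Cb m n (ℕₚ.m⊔n≤o⇒n≤o N₁ N₂ N≤m′) (ℕₚ.m⊔n≤o⇒n≤o N₁ N₂ N≤n′)))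
                  (*-monoʳ-<-pos B {{positive 0<B}} (Ca m n (ℕₚ.m⊔n≤o⇒m≤o N₁ N₂ N≤m′) (ℕₚ.m⊔n≤o⇒m≤o N₁ N₂ N≤n′))) ⟩
    A * (recip A * (½ * ε)) + B * (recip B * (½ * ε))
      ≡⟨ cong₂ _+_ (cancel 0<A) (cancel 0<B) ⟩
    ½ * ε + ½ * ε
      ≡⟨ half+half ε ⟩
    ε ∎
    where
    open ≤-Reasoning
    cancel : ∀ {p r} → 0ℚ < p → p * (recip p * r) ≡ r
    cancel {p} {r} 0<p = trans (sym (*-assoc p (recip p) r))
      (trans (cong (_* r) (trans (*-comm p (recip p)) (recip-inverse 0<p))) (*-identityˡ r))

  recip-cauchy : ∀ a → IsCauchy a →
    (Σ[ q ∈ ℚ ] 0ℚ < q × ∃[ N ] (∀ n → N ℕ.≤ n → 0ℚ + q ≤ a n)) → IsCauchy (λ n → recip (a n))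
  recip-cauchy a ca (q , 0<q , N₁ , bound) ε 0<ε =
    let w = recip q
        0<w = recip-pos 0<q
        N₂ , C = ca ((q * q) * ε) (*-pos (*-pos 0<q 0<q) 0<ε)
    in N₁ ℕ.⊔ N₂ , λ m n N≤m N≤n →
    let q≤m = subst (_≤ a m) (+-identityˡ q) (bound m (ℕₚ.m⊔n≤o⇒m≤o N₁ N₂ N≤m))
        q≤n = subst (_≤ a n) (+-identityˡ q) (bound n (ℕₚ.m⊔n≤o⇒m≤o N₁ N₂ N≤n))
        0<m = <-≤-trans 0<q q≤m
        0<n = <-≤-trans 0<q q≤n
        u = recip (a m)
        v = recip (a n)
        0≤u = <⇒≤ (recip-pos 0<m)
        0≤v = <⇒≤ (recip-pos 0<n)
    in begin-strict
    ∣ u - v ∣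
      ≡⟨ cong ∣_∣ (cong₂ _-_ (times-1 u (recip-inverse 0<n)) (times-1 v (recip-inverse 0<m))) ⟩
    ∣ u * (v * a n) - v * (u * a m) ∣
      ≡⟨ cong ∣_∣ (solve 4 (λ u v x y → u :* (v :* y) :+ :- (v :* (u :* x)) := (u :* v) :* (y :+ :- x)) refl u v (a m) (a n)) ⟩
    ∣ (u * v) * (a n - a m) ∣
      ≡⟨ ∣p*q∣≡∣p∣*∣q∣ (u * v) (a n - a m) ⟩
    ∣ u * v ∣ * ∣ a n - a m ∣
      ≡⟨ cong (_* ∣ a n - a m ∣) (0≤p⇒∣p∣≡p (*-nonNeg 0≤u 0≤v)) ⟩
    (u * v) * ∣ a n - a m ∣
      ≤⟨ *-monoʳ-≤-nonNeg ∣ a n - a m ∣ {{∣-∣-nonNeg (a n - a m)}}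
           (*-mono-≤ 0≤u (<⇒≤ 0<w) (recip-anti 0<q q≤m) (recip-anti 0<q q≤n)) ⟩
    (w * w) * ∣ a n - a m ∣
      <⟨ *-monoʳ-<-pos (w * w) {{positive (*-pos 0<w 0<w)}}
           (C n m (ℕₚ.m⊔n≤o⇒n≤o N₁ N₂ N≤n) (ℕₚ.m⊔n≤o⇒n≤o N₁ N₂ N≤m)) ⟩
    (w * w) * ((q * q) * ε)
      ≡⟨ solve 3 (λ w q e → (w :* w) :* ((q :* q) :* e) := ((w :* q) :* (w :* q)) :* e) refl w q ε ⟩
    ((w * q) * (w * q)) * ε
      ≡⟨ cong (λ z → (z * z) * ε) (recip-inverse 0<q) ⟩
    (1ℚ * 1ℚ) * ε
      ≡⟨ *-identityˡ ε ⟩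
    ε ∎
    where
    open ≤-Reasoning
    times-1 : ∀ p {r} → r ≡ 1ℚ → p ≡ p * r
    times-1 p refl = sym (*-identityʳ p)

  sqrt-cauchy : ∀ a → IsCauchy a → IsCauchy (λ n → sqrtApprox n (a n))
  sqrt-cauchy a ca ε 0<ε =
    let N₁ , C = ca (h * h) (*-pos 0<h 0<h)
        N₂ , U = archimedean h 0<h
    in N₁ ℕ.⊔ N₂ , λ m n N≤m N≤n →
    let m₁ = ℕₚ.m⊔n≤o⇒m≤o N₁ N₂ N≤m
        n₁ = ℕₚ.m⊔n≤o⇒m≤o N₁ N₂ N≤n
        m₂ = ℕₚ.m⊔n≤o⇒n≤o N₁ N₂ N≤m
        n₂ = ℕₚ.m⊔n≤o⇒n≤o N₁ N₂ N≤n
    in ∣p-q∣<ε (close m n (C m n m₁ n₁) (U n n₂)) (close n m (C n m n₁ m₁) (U m m₂))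
    where
    open ≤-Reasoning
    h : ℚ
    h = ½ * ε
    0<h : 0ℚ < h
    0<h = half-pos 0<ε
    close : ∀ m n → ∣ a m - a n ∣ < h * h → unit n ≤ h → sqrtApprox m (a m) < sqrtApprox n (a n) + ε
    close m n am-an e≤h = ≰⇒> λ t+ε≤s → <-irrefl refl (begin-strict
      ∣ a m ∣                                  ≤⟨ ∣p∣≤∣q∣+∣p-q∣ (a m) (a n) ⟩
      ∣ a n ∣ + ∣ a m - a n ∣                  <⟨ +-mono-< (sqrtApprox-upper n (a n)) am-an ⟩
      (t + unit n) * (t + unit n) + h * h      ≤⟨ +-monoˡ-≤ (h * h) (square-mono-≤ (+-nonNeg 0≤t (<⇒≤ (unit-pos n)))
                                                    (+-monoʳ-≤ t e≤h)) ⟩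
      (t + h) * (t + h) + h * h                ≤⟨ p≤p+q _ (+-nonNeg (+-nonNeg th th) (+-nonNeg hh hh)) ⟩
      ((t + h) * (t + h) + h * h) + ((t * h + t * h) + (h * h + h * h))
        ≡⟨ solve 2 (λ t h → ((t :+ h) :* (t :+ h) :+ h :* h) :+ ((t :* h :+ t :* h) :+ (h :* h :+ h :* h)) := (t :+ (h :+ h)) :* (t :+ (h :+ h))) refl t h ⟩
      (t + (h + h)) * (t + (h + h))            ≡⟨ cong (λ z → (t + z) * (t + z)) (half+half ε) ⟩
      (t + ε) * (t + ε)                        ≤⟨ square-mono-≤ (+-nonNeg 0≤t (<⇒≤ 0<ε)) t+ε≤s ⟩
      s * s                                    ≤⟨ sqrtApprox-lower m (a m) ⟩
      ∣ a m ∣                                  ∎)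
      where
      s t : ℚ
      s = sqrtApprox m (a m)
      t = sqrtApprox n (a n)
      0≤t : 0ℚ ≤ t
      0≤t = sqrtApprox-nonNeg n (a n)
      th : 0ℚ ≤ t * h
      th = *-nonNeg 0≤t (<⇒≤ 0<h)
      hh : 0ℚ ≤ h * h
      hh = square-nonNeg h

ℚ→ℝ : ℚ → ℝ
ℚ→ℝ q = mkℝ (λ _ → q) (const-cauchy q)

0ᴿ 1ᴿ : ℝ
0ᴿ = ℚ→ℝ 0ℚ
1ᴿ = ℚ→ℝ 1ℚ

infixl 6 _+ᴿ_ _-ᴿ_
infixl 7 _*ᴿ_
infix  8 -ᴿ_

_+ᴿ_ _*ᴿ_ : ℝ → ℝ → ℝ
x +ᴿ y = mkℝ (λ n → seq x n + seq y n) (+-cauchy (seq x) (seq y) (cauchy x) (cauchy y))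
x *ᴿ y = mkℝ (λ n → seq x n * seq y n) (*-cauchy (seq x) (seq y) (cauchy x) (cauchy y))

-ᴿ_ : ℝ → ℝ
-ᴿ x = mkℝ (λ n → - seq x n) (neg-cauchy (seq x) (cauchy x))

_-ᴿ_ : ℝ → ℝ → ℝ
x -ᴿ y = x +ᴿ (-ᴿ y)

recipᴿ : (x : ℝ) → 0ᴿ <ᴿ x → ℝ
recipᴿ x 0<x = mkℝ (λ n → recip (seq x n)) (recip-cauchy (seq x) (cauchy x) 0<x)

-- √∣ x ∣; only used for x ≥ 0.
sqrtᴿ : ℝ → ℝ
sqrtᴿ x = mkℝ (λ n → sqrtApprox n (seq x n)) (sqrt-cauchy (seq x) (cauchy x))

record ℂ : Set where
  constructor _+i_
  field
    re im : ℝ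

open ℂ public

infix  4 _≈ᶜ_
infixl 6 _+ᶜ_ _-ᶜ_
infixl 7 _*ᶜ_
infix  8 -ᶜ_

_≈ᶜ_ : ℂ → ℂ → Set
z ≈ᶜ w = re z ≈ᴿ re w × im z ≈ᴿ im w

_+ᶜ_ _*ᶜ_ : ℂ → ℂ → ℂ
z +ᶜ w = (re z +ᴿ re w) +i (im z +ᴿ im w)
z *ᶜ w = (re z *ᴿ re w -ᴿ im z *ᴿ im w) +i (re z *ᴿ im w +ᴿ im z *ᴿ re w)

-ᶜ_ : ℂ → ℂ
-ᶜ z = (-ᴿ re z) +i (-ᴿ im z)

_-ᶜ_ : ℂ → ℂ → ℂ
z -ᶜ w = z +ᶜ (-ᶜ w)

ℚ→ℂ : ℚ → ℂ
ℚ→ℂ q = ℚ→ℝ q +i 0ᴿ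

ℕ→ℂ : ℕ → ℂ
ℕ→ℂ n = ℚ→ℂ (fromℕ n)

0ᶜ 1ᶜ : ℂ
0ᶜ = ℚ→ℂ 0ℚ
1ᶜ = ℚ→ℂ 1ℚ

normSq : ℂ → ℝ
normSq z = re z *ᴿ re z +ᴿ im z *ᴿ im z

∣_∣ᶜ : ℂ → ℝ
∣ z ∣ᶜ = sqrtᴿ (normSq z)

-- Apartness from 0: constructively stronger than the negation of z ≈ᶜ 0ᶜ,
-- and what the reciprocal requires.
_#0 : ℂ → Set
z #0 = 0ᴿ <ᴿ normSq z

recipᶜ : (z : ℂ) → z #0 → ℂ
recipᶜ z z#0 = (re z *ᴿ r) +i ((-ᴿ im z) *ᴿ r)
  where r = recipᴿ (normSq z) z#0

ℂ-rawRing : RawRing 0ℓ 0ℓ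
ℂ-rawRing = record
  { Carrier = ℂ ; _≈_ = _≈ᶜ_
  ; _+_ = _+ᶜ_ ; _*_ = _*ᶜ_ ; -_ = -ᶜ_ ; 0# = 0ᶜ ; 1# = 1ᶜ }

open RawSemiringDefs (RawRing.rawSemiring ℂ-rawRing) public
  using () renaming (_^_ to _^ᶜ_; sum to sumᶜ)

∑< : ℕ → (ℕ → ℂ) → ℂ
∑< n f = sumᶜ {n} (λ i → f (toℕ i))

∑≤ : ℕ → (ℕ → ℂ) → ℂ
∑≤ n = ∑< (suc n)

-- The series ∑_{n ≥ 0} f n converges to s.
HasSum : (ℕ → ℂ) → ℂ → Set
HasSum f s = ∀ ε → 0ᴿ <ᴿ ε → ∃[ N ] (∀ n → N ℕ.≤ n → ∣ ∑< n f -ᶜ s ∣ᶜ <ᴿ ε)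

record Disc : Set where
  constructor mkDisc
  field
    pt   : ℂ
    pt<1 : ∣ pt ∣ᶜ <ᴿ 1ᴿ

open Disc public

-- g is the derivative of f on the disc: g x is the limit of the difference
-- quotient (f y - f x) / (y - x) as y tends to x with y ≠ x.
IsDerivative : (f g : Disc → ℂ) → Set
IsDerivative f g = ∀ x ε → 0ᴿ <ᴿ ε → Σ[ δ ∈ ℝ ] 0ᴿ <ᴿ δ ×
  (∀ y (y#x : (pt y -ᶜ pt x) #0) → ∣ pt y -ᶜ pt x ∣ᶜ <ᴿ δ →
    ∣ (f y -ᶜ f x) *ᶜ recipᶜ (pt y -ᶜ pt x) y#x -ᶜ g x ∣ᶜ <ᴿ ε)

IsIteratedDerivative : ℕ → (f g : Disc → ℂ) → Set
IsIteratedDerivative zero    f g = ∀ x → f x ≈ᶜ g x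
IsIteratedDerivative (suc r) f g =
  Σ[ f′ ∈ (Disc → ℂ) ] IsDerivative f f′ × IsIteratedDerivative r f′ g

-- (d/dx)ʳ f exists on the disc and takes the value d at x.
HasIteratedDerivativeAt : ℕ → (Disc → ℂ) → Disc → ℂ → Set
HasIteratedDerivativeAt r f x d =
  Σ[ g ∈ (Disc → ℂ) ] IsIteratedDerivative r f g × g x ≈ᶜ d

opaque

  1-x#0 : ∀ (x : Disc) → (1ᶜ -ᶜ pt x) #0
  1-x#0 (mkDisc z (q , 0<q , N₁ , bound)) =
    let N₂ , U = archimedean h 0<h
    in h * h , *-pos 0<h 0<h , N₁ ℕ.⊔ N₂ , λ n N≤n →
    below n (bound n (ℕₚ.m⊔n≤o⇒m≤o N₁ N₂ N≤n)) (U n (ℕₚ.m⊔n≤o⇒n≤o N₁ N₂ N≤n))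
    where
    open ≤-Reasoning
    h : ℚ
    h = ½ * q
    0<h : 0ℚ < h
    0<h = half-pos 0<q
    below : ∀ n → seq ∣ z ∣ᶜ n + q ≤ 1ℚ → unit n ≤ h → 0ℚ + h * h ≤ seq (normSq (1ᶜ -ᶜ z)) n
    below n s+q≤1 e≤h = begin
      0ℚ + h * h                                      ≡⟨ +-identityˡ (h * h) ⟩
      h * h                                           ≤⟨ square-mono-≤ (<⇒≤ 0<h) h≤1-a ⟩
      (1ℚ - a) * (1ℚ - a)                             ≤⟨ p≤p+q _ (square-nonNeg (0ℚ - b)) ⟩
      (1ℚ - a) * (1ℚ - a) + (0ℚ - b) * (0ℚ - b)       ∎
      where
      a b t s c : ℚ
      a = seq (re z) n
      b = seq (im z) n
      t = a * a + b * b
      s = sqrtApprox n t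
      c = 1ℚ - h
      0≤s+e : 0ℚ ≤ s + unit n
      0≤s+e = +-nonNeg (sqrtApprox-nonNeg n t) (<⇒≤ (unit-pos n))
      s+e≤c : s + unit n ≤ c
      s+e≤c = begin
        s + unit n                ≤⟨ +-monoʳ-≤ s e≤h ⟩
        s + h                     ≡⟨ solve 2 (λ s h → s :+ h := (s :+ (h :+ h)) :+ :- h) refl s h ⟩
        (s + (h + h)) - h         ≡⟨ cong (λ w → (s + w) - h) (half+half q) ⟩
        (s + q) - h               ≤⟨ +-monoˡ-≤ (- h) s+q≤1 ⟩
        1ℚ - h                    ∎
      a<c : a < c
      a<c = ≰⇒> λ c≤a → <-irrefl refl (begin-strict
        a * a                           ≤⟨ p≤p+q _ (square-nonNeg b) ⟩
        t                               ≤⟨ p≤∣p∣ t ⟩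
        ∣ t ∣                           <⟨ sqrtApprox-upper n t ⟩
        (s + unit n) * (s + unit n)     ≤⟨ square-mono-≤ 0≤s+e s+e≤c ⟩
        c * c                           ≤⟨ square-mono-≤ (≤-trans 0≤s+e s+e≤c) c≤a ⟩
        a * a                           ∎)
      h≤1-a : h ≤ 1ℚ - a
      h≤1-a = subst₂ _≤_ (solve 2 (λ a h → (a :+ h) :+ :- a := h) refl a h)
        (cong (_- a) (solve 1 (λ h → (con 1ℚ :+ :- h) :+ h := con 1ℚ) refl h))
        (+-monoˡ-≤ (- a) (+-monoˡ-≤ h (<⇒≤ a<c)))

1/1-_ : Disc → ℂ
1/1- x = recipᶜ (1ᶜ -ᶜ pt x) (1-x#0 x)

-- Stirling numbers of the second kind, by their standard recurrence.
S : ℕ → ℕ → ℕ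
S zero    zero    = 1
S zero    (suc k) = 0
S (suc n) zero    = 0
S (suc n) (suc k) = suc k ℕ.* S n (suc k) ℕ.+ S n k

1/_!ᶜ : ℕ → ℂ
1/ r !ᶜ = ℚ→ℂ ((+ 1 / (r !)) {{r ℕₚ.!≢0}})

-- Geometric polynomials.
ω : ℕ → ℂ → ℂ
ω n x = ∑≤ n λ k → ℕ→ℂ (S n k ℕ.* k !) *ᶜ x ^ᶜ k

-- Generalized geometric polynomials; ωGen n r is ω_{n,r+1}, so the second index is
-- shifted by one.
ωGen : ℕ → ℕ → ℂ → ℂ
ωGen n r x = 1/ r !ᶜ *ᶜ ∑≤ n λ k → ℕ→ℂ (S n k ℕ.* (k ℕ.+ r) !) *ᶜ x ^ᶜ k

{-# OPTIONS --safe #-}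
module Submission where

-- Let u = 1/(1 - y).  Multiplication by y and by u shift a coefficient sequence and replace it by its
-- partial sums, so every expression built from y and u has an explicit power series with natural
-- coefficients, and differentiation acts on both sides.  Summing the Stirling expansion
-- n^p = Σ_j S(p,j) n(n-1)...(n-j+1) against these series gives, with c_k = C(r+k,k) and
-- B_k = Σ_{n<k} n^p,
--   (1/r!) (d/dx)^r (x^r u^2 ω_p(x u)) = Σ_k c_k B_{k+1} x^k,   u^{r+1} ω_{p,r+1}(x u) = Σ_k c_k k^p x^k.
-- Their difference is Σ_k c_k B_k x^k.  With T_n the tail of Σ_k c_k x^k = u^{r+1} after degree n,
-- Abel summation gives Σ_{n<N} n^p T_n = B_N T_N + Σ_{k≤N} c_k B_k x^k, and B_N T_N tends to 0.

open import Defs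
open import Data.Nat using (ℕ; suc; _+_; _^_; _<_)
open import Data.Nat.Combinatorics using (_C_)
open import Data.Product using (Σ-syntax; _×_)

open import Algebra.Bundles using (CommutativeRing)
import Algebra.Solver.Ring
import Algebra.Solver.Ring.AlmostCommutativeRing as ACR
import Data.Integer as ℤ
open import Data.Maybe using (Maybe; just; nothing)
open import Data.Nat using (zero; _*_; _∸_; _/_; _≤_; _⊔_; _!; s≤s; NonZero)
open import Data.Nat.Combinatorics using (nCk≡n!/k![n-k]!; k![n∸k]!∣n!; nCn≡1; nCk+nC[k+1]≡[n+1]C[k+1])
open import Data.Nat.DivMod using (m/n*n≡m)
import Data.Nat.Properties as ℕₚ
import Data.Nat.Solver as ℕSolver
open import Data.Product using (∃-syntax; _,_; proj₁; proj₂)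
open import Data.Rational as ℚ using (ℚ; 0ℚ; 1ℚ; ½)
import Data.Rational.Properties as ℚₚ
open import Algebra.Definitions.RawSemiring ℚ.+-*-rawSemiring using () renaming (_^_ to _^ℚ_)
import Data.Rational.Solver as ℚSolver
open import Data.Sum using (inj₁; inj₂)
open import Level using (0ℓ)
import Relation.Binary.Reasoning.Setoid
open import Relation.Binary.PropositionalEquality
open import Relation.Nullary using (yes; no)

-- Termwise differentiation is not proved for arbitrary power series. The syntax `Term` contains
-- just the operations that occur, so convergence to the value, differentiability and the
-- coefficients of a derivative are each a structural induction. Coefficients are natural numbers so
-- that a rational ρ < 1 with |x| ≤ ρ majorises every series by a nonnegative rational one. The
-- price is that 1/r! cannot occur inside a term: coefficient identities carry a factor r!, removed
-- only when the expansions are combined. Decay of the n-th term of e comes from a bound on the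
-- majorant of (y e(y))', which contains n + 1 times that term. The delicate limit is B_N T_N, a
-- tail against a growing weight. The tail is never estimated as an infinite sum. Induction on the
-- exponent m of u^m writes it through boundary terms with coefficients B_n C(m+n,n), and these are
-- dominated by the coefficients of the m-th derivative of x^m u^2 ω_p(x u), so the decay already
-- proved for terms applies.

-- Eventual equality of approximants and the ring structure of ℂ

Eventually : (ℕ → Set) → Set
Eventually P = ∃[ N ] (∀ n → N ≤ n → P n)

eventually-map : ∀ {P Q : ℕ → Set} → (∀ n → P n → Q n) → Eventually P → Eventually Q
eventually-map f (N , p) = N , λ n N≤n → f n (p n N≤n)

eventually-map₂ : ∀ {P Q R : ℕ → Set} → (∀ n → P n → Q n → R n) →
  Eventually P → Eventually Q → Eventually R
eventually-map₂ f (M , p) (N , q) = M ⊔ N , λ n le →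
  f n (p n (ℕₚ.m⊔n≤o⇒m≤o M N le)) (q n (ℕₚ.m⊔n≤o⇒n≤o M N le))

-- Eventual equality of the representing sequences is finer than _≈ᶜ_, but already makes
-- ℂ a commutative ring in which recipᶜ inverts, and unlike _≈ᶜ_ it preserves rational
-- bounds exactly.
infix 4 _≋_

record _≋_ (z w : ℂ) : Set where
  constructor mk≋
  field
    eventually≡ : Eventually (λ n → seq (re z) n ≡ seq (re w) n × seq (im z) n ≡ seq (im w) n)

always≡ : ∀ {z w} → (∀ n → seq (re z) n ≡ seq (re w) n) → (∀ n → seq (im z) n ≡ seq (im w) n) → z ≋ w
always≡ p q = mk≋ (0 , λ n _ → p n , q n)

module _ where
  open ℚSolver.+-*-Solver using (solve; _:=_; _:+_; _:*_; :-_; con)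

  ℂ-commutativeRing : CommutativeRing 0ℓ 0ℓ
  ℂ-commutativeRing = record
    { Carrier = ℂ ; _≈_ = _≋_ ; _+_ = _+ᶜ_ ; _*_ = _*ᶜ_ ; -_ = -ᶜ_ ; 0# = 0ᶜ ; 1# = 1ᶜ
    ; isCommutativeRing = record
      { isRing = record
        { +-isAbelianGroup = record
          { isGroup = record
            { isMonoid = record
              { isSemigroup = record
                { isMagma = record
                  { isEquivalence = record
                    { refl  = always≡ (λ _ → refl) (λ _ → refl)
                    ; sym   = λ (mk≋ e) → mk≋ (eventually-map (λ { _ (p , q) → sym p , sym q }) e)
                    ; trans = λ (mk≋ e) (mk≋ e′) →
                        mk≋ (eventually-map₂ (λ { _ (p , q) (p′ , q′) → trans p p′ , trans q q′ }) e e′)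
                    }
                  ; ∙-cong = λ (mk≋ e) (mk≋ e′) → mk≋ (eventually-map₂
                      (λ { _ (p , q) (p′ , q′) → cong₂ ℚ._+_ p p′ , cong₂ ℚ._+_ q q′ }) e e′)
                  }
                ; assoc = λ x y z → always≡
                    (λ n → ℚₚ.+-assoc (seq (re x) n) (seq (re y) n) (seq (re z) n))
                    (λ n → ℚₚ.+-assoc (seq (im x) n) (seq (im y) n) (seq (im z) n))
                }
              ; identity =
                  (λ x → always≡ (λ n → ℚₚ.+-identityˡ (seq (re x) n)) (λ n → ℚₚ.+-identityˡ (seq (im x) n)))
                , (λ x → always≡ (λ n → ℚₚ.+-identityʳ (seq (re x) n)) (λ n → ℚₚ.+-identityʳ (seq (im x) n)))
              }
            ; inverse =
                (λ x → always≡ (λ n → ℚₚ.+-inverseˡ (seq (re x) n)) (λ n → ℚₚ.+-inverseˡ (seq (im x) n)))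
              , (λ x → always≡ (λ n → ℚₚ.+-inverseʳ (seq (re x) n)) (λ n → ℚₚ.+-inverseʳ (seq (im x) n)))
            ; ⁻¹-cong = λ (mk≋ e) →
                mk≋ (eventually-map (λ { _ (p , q) → cong ℚ.-_ p , cong ℚ.-_ q }) e)
            }
          ; comm = λ x y → always≡
              (λ n → ℚₚ.+-comm (seq (re x) n) (seq (re y) n))
              (λ n → ℚₚ.+-comm (seq (im x) n) (seq (im y) n))
          }
        ; *-cong = λ (mk≋ e) (mk≋ e′) → mk≋ (eventually-map₂
            (λ { _ (p , q) (p′ , q′) →
                 cong₂ ℚ._+_ (cong₂ ℚ._*_ p p′) (cong ℚ.-_ (cong₂ ℚ._*_ q q′))
               , cong₂ ℚ._+_ (cong₂ ℚ._*_ p q′) (cong₂ ℚ._*_ q p′) }) e e′)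
        ; *-assoc = λ x y z → always≡
            (λ n → solve 6 (λ a b c d e f →
                (a :* c :+ :- (b :* d)) :* e :+ :- ((a :* d :+ b :* c) :* f)
                := a :* (c :* e :+ :- (d :* f)) :+ :- (b :* (c :* f :+ d :* e))) refl
              (seq (re x) n) (seq (im x) n) (seq (re y) n) (seq (im y) n) (seq (re z) n) (seq (im z) n))
            (λ n → solve 6 (λ a b c d e f →
                (a :* c :+ :- (b :* d)) :* f :+ (a :* d :+ b :* c) :* e
                := a :* (c :* f :+ d :* e) :+ b :* (c :* e :+ :- (d :* f))) refl
              (seq (re x) n) (seq (im x) n) (seq (re y) n) (seq (im y) n) (seq (re z) n) (seq (im z) n))
        ; *-identity =
            (λ x → always≡
              (λ n → solve 2 (λ a b → con 1ℚ :* a :+ :- (con 0ℚ :* b) := a) refl (seq (re x) n) (seq (im x) n))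
              (λ n → solve 2 (λ a b → con 1ℚ :* b :+ con 0ℚ :* a := b) refl (seq (re x) n) (seq (im x) n)))
          , (λ x → always≡
              (λ n → solve 2 (λ a b → a :* con 1ℚ :+ :- (b :* con 0ℚ) := a) refl (seq (re x) n) (seq (im x) n))
              (λ n → solve 2 (λ a b → a :* con 0ℚ :+ b :* con 1ℚ := b) refl (seq (re x) n) (seq (im x) n)))
        ; distrib =
            (λ x y z → always≡
              (λ n → solve 6 (λ a b c d e f →
                  a :* (c :+ e) :+ :- (b :* (d :+ f))
                  := (a :* c :+ :- (b :* d)) :+ (a :* e :+ :- (b :* f))) refl
                (seq (re x) n) (seq (im x) n) (seq (re y) n) (seq (im y) n) (seq (re z) n) (seq (im z) n))
              (λ n → solve 6 (λ a b c d e f →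
                  a :* (d :+ f) :+ b :* (c :+ e) := (a :* d :+ b :* c) :+ (a :* f :+ b :* e)) refl
                (seq (re x) n) (seq (im x) n) (seq (re y) n) (seq (im y) n) (seq (re z) n) (seq (im z) n)))
          , (λ x y z → always≡
              (λ n → solve 6 (λ a b c d e f →
                  (c :+ e) :* a :+ :- ((d :+ f) :* b)
                  := (c :* a :+ :- (d :* b)) :+ (e :* a :+ :- (f :* b))) refl
                (seq (re x) n) (seq (im x) n) (seq (re y) n) (seq (im y) n) (seq (re z) n) (seq (im z) n))
              (λ n → solve 6 (λ a b c d e f →
                  (c :+ e) :* b :+ (d :+ f) :* a := (c :* b :+ d :* a) :+ (e :* b :+ f :* a)) refl
                (seq (re x) n) (seq (im x) n) (seq (re y) n) (seq (im y) n) (seq (re z) n) (seq (im z) n)))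
        }
      ; *-comm = λ x y → always≡
          (λ n → solve 4 (λ a b c d → a :* c :+ :- (b :* d) := c :* a :+ :- (d :* b)) refl
            (seq (re x) n) (seq (im x) n) (seq (re y) n) (seq (im y) n))
          (λ n → solve 4 (λ a b c d → a :* d :+ b :* c := c :* b :+ d :* a) refl
            (seq (re x) n) (seq (im x) n) (seq (re y) n) (seq (im y) n))
      }
    }

  ℚ→ℂ-+ : ∀ p q → ℚ→ℂ (p ℚ.+ q) ≋ ℚ→ℂ p +ᶜ ℚ→ℂ q
  ℚ→ℂ-+ p q = always≡ (λ _ → refl) (λ _ → refl)

  ℚ→ℂ-* : ∀ p q → ℚ→ℂ (p ℚ.* q) ≋ ℚ→ℂ p *ᶜ ℚ→ℂ q
  ℚ→ℂ-* p q = always≡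
    (λ _ → solve 2 (λ a b → a :* b := a :* b :+ :- (con 0ℚ :* con 0ℚ)) refl p q)
    (λ _ → solve 2 (λ a b → con 0ℚ := a :* con 0ℚ :+ con 0ℚ :* b) refl p q)

  ℚ→ℂ-neg : ∀ p → ℚ→ℂ (ℚ.- p) ≋ -ᶜ ℚ→ℂ p
  ℚ→ℂ-neg p = always≡ (λ _ → refl) (λ _ → refl)

open CommutativeRing ℂ-commutativeRing using () renaming
  ( refl to ≋-refl; sym to ≋-sym; trans to ≋-trans; reflexive to ≋-reflexive; setoid to ≋-setoid
  ; +-cong to +ᶜ-cong; *-cong to *ᶜ-cong; -‿cong to -ᶜ-cong
  ; +-identityˡ to +ᶜ-identityˡ; *-identityˡ to *ᶜ-identityˡ)

ℚ→ℂ-≟ : ∀ p q → Maybe (ℚ→ℂ p ≋ ℚ→ℂ q)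
ℚ→ℂ-≟ p q with p ℚₚ.≟ q
... | yes refl = just ≋-refl
... | no  _    = nothing

ℚ→ℂ-morphism : ℚ.+-*-rawRing ACR.-Raw-AlmostCommutative⟶ ACR.fromCommutativeRing ℂ-commutativeRing
ℚ→ℂ-morphism = record
  { ⟦_⟧ = ℚ→ℂ ; +-homo = ℚ→ℂ-+ ; *-homo = ℚ→ℂ-* ; -‿homo = ℚ→ℂ-neg
  ; 0-homo = ≋-refl ; 1-homo = ≋-refl }

-- Rational coefficients make `con 0ℚ` and `con 1ℚ` evaluate to `0ᶜ` and `1ᶜ` themselves.
module ≋-Solver = Algebra.Solver.Ring ℚ.+-*-rawRing (ACR.fromCommutativeRing ℂ-commutativeRing) ℚ→ℂ-morphism ℚ→ℂ-≟

-- Rational bounds on complex numbers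

infix 4 _≲_

-- Squares are compared because the approximants of `normSq z` are exact polynomials in those of
-- `z`, whereas those of `∣ z ∣ᶜ` carry rounding errors. The sign condition on `q` makes comparing
-- squares equivalent to comparing absolute values.
record _≲_ (z : ℂ) (q : ℚ) : Set where
  constructor mk≲
  field
    bound-nonNeg : 0ℚ ℚ.≤ q
    normSq-bound : Eventually (λ n → seq (normSq z) n ℚ.≤ q ℚ.* q)

open _≲_

square-cancel-≤ : ∀ p {q} → 0ℚ ℚ.≤ q → p ℚ.* p ℚ.≤ q ℚ.* q → p ℚ.≤ q
square-cancel-≤ p {q} 0≤q pp≤qq = ℚₚ.≮⇒≥ λ q<p → ℚₚ.<-irrefl refl (ℚₚ.<-≤-trans
  (ℚₚ.≤-<-trans (ℚₚ.*-monoˡ-≤-nonNeg q {{ℚ.nonNegative 0≤q}} (ℚₚ.<⇒≤ q<p))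
    (ℚₚ.*-monoˡ-<-pos p {{ℚ.positive (ℚₚ.≤-<-trans 0≤q q<p)}} q<p)) pp≤qq)

module _ where
  open ℚSolver.+-*-Solver using (solve; _:=_; _:+_; _:*_; :-_; con)

  -- The Cauchy–Schwarz inequality ac + bd ≤ pq comes from
  -- (ac + bd)² + (ad − bc)² = (a² + b²)(c² + d²).
  normSq-triangle : ∀ {a b c d p q} → 0ℚ ℚ.≤ p → 0ℚ ℚ.≤ q →
    a ℚ.* a ℚ.+ b ℚ.* b ℚ.≤ p ℚ.* p → c ℚ.* c ℚ.+ d ℚ.* d ℚ.≤ q ℚ.* q →
    (a ℚ.+ c) ℚ.* (a ℚ.+ c) ℚ.+ (b ℚ.+ d) ℚ.* (b ℚ.+ d) ℚ.≤ (p ℚ.+ q) ℚ.* (p ℚ.+ q)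
  normSq-triangle {a} {b} {c} {d} {p} {q} 0≤p 0≤q ab cd = begin
    (a ℚ.+ c) ℚ.* (a ℚ.+ c) ℚ.+ (b ℚ.+ d) ℚ.* (b ℚ.+ d)
      ≡⟨ solve 4 (λ a b c d → (a :+ c) :* (a :+ c) :+ (b :+ d) :* (b :+ d)
           := ((a :* a :+ b :* b) :+ (c :* c :+ d :* d)) :+ ((a :* c :+ b :* d) :+ (a :* c :+ b :* d))) refl a b c d ⟩
    ((a ℚ.* a ℚ.+ b ℚ.* b) ℚ.+ (c ℚ.* c ℚ.+ d ℚ.* d)) ℚ.+ (s ℚ.+ s)
      ≤⟨ ℚₚ.+-mono-≤ (ℚₚ.+-mono-≤ ab cd) (ℚₚ.+-mono-≤ s≤pq s≤pq) ⟩
    (p ℚ.* p ℚ.+ q ℚ.* q) ℚ.+ (p ℚ.* q ℚ.+ p ℚ.* q)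
      ≡⟨ solve 2 (λ p q → (p :* p :+ q :* q) :+ (p :* q :+ p :* q) := (p :+ q) :* (p :+ q)) refl p q ⟩
    (p ℚ.+ q) ℚ.* (p ℚ.+ q) ∎
    where
    open ℚₚ.≤-Reasoning
    s t : ℚ
    s = a ℚ.* c ℚ.+ b ℚ.* d
    t = a ℚ.* d ℚ.- b ℚ.* c
    s≤pq : s ℚ.≤ p ℚ.* q
    s≤pq = square-cancel-≤ s (*-nonNeg 0≤p 0≤q) (begin
      s ℚ.* s                    ≤⟨ p≤p+q _ (square-nonNeg t) ⟩
      s ℚ.* s ℚ.+ t ℚ.* t
        ≡⟨ solve 4 (λ a b c d → (a :* c :+ b :* d) :* (a :* c :+ b :* d) :+ (a :* d :+ :- (b :* c)) :* (a :* d :+ :- (b :* c))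
             := (a :* a :+ b :* b) :* (c :* c :+ d :* d)) refl a b c d ⟩
      (a ℚ.* a ℚ.+ b ℚ.* b) ℚ.* (c ℚ.* c ℚ.+ d ℚ.* d)
        ≤⟨ *-mono-≤ (+-nonNeg (square-nonNeg a) (square-nonNeg b)) (square-nonNeg q) ab cd ⟩
      (p ℚ.* p) ℚ.* (q ℚ.* q)
        ≡⟨ solve 2 (λ p q → (p :* p) :* (q :* q) := (p :* q) :* (p :* q)) refl p q ⟩
      (p ℚ.* q) ℚ.* (p ℚ.* q)    ∎)

  ≲-+ : ∀ {z w p q} → z ≲ p → w ≲ q → z +ᶜ w ≲ p ℚ.+ q
  ≲-+ {z} {w} (mk≲ 0≤p zp) (mk≲ 0≤q wq) = mk≲ (+-nonNeg 0≤p 0≤q)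
    (eventually-map₂ (λ n → normSq-triangle {seq (re z) n} {seq (im z) n} {seq (re w) n} {seq (im w) n} 0≤p 0≤q) zp wq)

  -- Brahmagupta's identity: `normSq` is multiplicative already on approximants.
  ≲-* : ∀ {z w p q} → z ≲ p → w ≲ q → z *ᶜ w ≲ p ℚ.* q
  ≲-* {z} {w} {p} {q} (mk≲ 0≤p zp) (mk≲ 0≤q wq) = mk≲ (*-nonNeg 0≤p 0≤q)
    (eventually-map₂ (λ n zp wq → subst₂ ℚ._≤_
      (solve 4 (λ a b c d → (a :* a :+ b :* b) :* (c :* c :+ d :* d)
        := (a :* c :+ :- (b :* d)) :* (a :* c :+ :- (b :* d)) :+ (a :* d :+ b :* c) :* (a :* d :+ b :* c)) refl
        (seq (re z) n) (seq (im z) n) (seq (re w) n) (seq (im w) n))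
      (solve 2 (λ p q → (p :* p) :* (q :* q) := (p :* q) :* (p :* q)) refl p q)
      (*-mono-≤ (+-nonNeg (square-nonNeg (seq (re z) n)) (square-nonNeg (seq (im z) n))) (square-nonNeg q) zp wq)) zp wq)

  ≲-neg : ∀ {z p} → z ≲ p → -ᶜ z ≲ p
  ≲-neg {z} (mk≲ 0≤p zp) = mk≲ 0≤p (eventually-map (λ n → subst (ℚ._≤ _)
    (solve 2 (λ a b → a :* a :+ b :* b := (:- a) :* (:- a) :+ (:- b) :* (:- b)) refl (seq (re z) n) (seq (im z) n))) zp)

  ≲-ℚ→ℂ : ∀ {q} → 0ℚ ℚ.≤ q → ℚ→ℂ q ≲ q
  ≲-ℚ→ℂ {q} 0≤q = mk≲ 0≤q (0 , λ n _ → ℚₚ.≤-reflexive (ℚₚ.+-identityʳ (q ℚ.* q)))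

  ∣∣²-square : ∀ p → p ℚ.* p ≡ ℚ.∣ p ∣ ℚ.* ℚ.∣ p ∣
  ∣∣²-square p = trans (sym (ℚₚ.0≤p⇒∣p∣≡p (square-nonNeg p))) (ℚₚ.∣p*q∣≡∣p∣*∣q∣ p p)

  -- Bounds A and B of the two parts give A² + B² ≤ (A + B)², which avoids a square root.
  ≲-exists : ∀ z → ∃[ q ] 0ℚ ℚ.< q × z ≲ q
  ≲-exists z with cauchy-bounded (seq (re z)) (cauchy (re z)) | cauchy-bounded (seq (im z)) (cauchy (im z))
  ... | A , 0<A , evA | B , 0<B , evB = A ℚ.+ B , ℚₚ.+-mono-< 0<A 0<B , mk≲ (+-nonNeg 0≤A 0≤B) (eventually-map₂ le evA evB)
    where
    open ℚₚ.≤-Reasoning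
    0≤A : 0ℚ ℚ.≤ A
    0≤A = ℚₚ.<⇒≤ 0<A
    0≤B : 0ℚ ℚ.≤ B
    0≤B = ℚₚ.<⇒≤ 0<B
    le : ∀ n → ℚ.∣ seq (re z) n ∣ ℚ.≤ A → ℚ.∣ seq (im z) n ∣ ℚ.≤ B →
      seq (normSq z) n ℚ.≤ (A ℚ.+ B) ℚ.* (A ℚ.+ B)
    le n a≤A b≤B = begin
      seq (normSq z) n
        ≡⟨ cong₂ ℚ._+_ (∣∣²-square (seq (re z) n)) (∣∣²-square (seq (im z) n)) ⟩
      ℚ.∣ seq (re z) n ∣ ℚ.* ℚ.∣ seq (re z) n ∣ ℚ.+ ℚ.∣ seq (im z) n ∣ ℚ.* ℚ.∣ seq (im z) n ∣
        ≤⟨ ℚₚ.+-mono-≤ (square-mono-≤ (ℚₚ.0≤∣p∣ (seq (re z) n)) a≤A) (square-mono-≤ (ℚₚ.0≤∣p∣ (seq (im z) n)) b≤B) ⟩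
      A ℚ.* A ℚ.+ B ℚ.* B
        ≤⟨ p≤p+q _ (+-nonNeg (*-nonNeg 0≤A 0≤B) (*-nonNeg 0≤A 0≤B)) ⟩
      (A ℚ.* A ℚ.+ B ℚ.* B) ℚ.+ (A ℚ.* B ℚ.+ A ℚ.* B)
        ≡⟨ solve 2 (λ p q → (p :* p :+ q :* q) :+ (p :* q :+ p :* q) := (p :+ q) :* (p :+ q)) refl A B ⟩
      (A ℚ.+ B) ℚ.* (A ℚ.+ B) ∎

  ≲-resp-≋ : ∀ {z w q} → z ≋ w → z ≲ q → w ≲ q
  ≲-resp-≋ (mk≋ e) (mk≲ 0≤q zq) = mk≲ 0≤q
    (eventually-map₂ (λ { n (p , r) → subst₂ (λ a b → a ℚ.* a ℚ.+ b ℚ.* b ℚ.≤ _) p r }) e zq)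

  ≲-mono : ∀ {z p q} → p ℚ.≤ q → z ≲ p → z ≲ q
  ≲-mono p≤q (mk≲ 0≤p zp) = mk≲ (ℚₚ.≤-trans 0≤p p≤q)
    (eventually-map (λ n le → ℚₚ.≤-trans le (square-mono-≤ 0≤p p≤q)) zp)

  -- Half of the gap δ absorbs the error `unit n` of the square root approximation; the other half
  -- keeps the new bound strictly below `q`.
  ∣∣ᶜ<⇒≲ : ∀ {z q} → ∣ z ∣ᶜ <ᴿ ℚ→ℝ q → ∃[ p ] p ℚ.< q × z ≲ p
  ∣∣ᶜ<⇒≲ {z} {q} (δ , 0<δ , M , gap) =
    -- The bound is nonnegative because at the index `K` it dominates `s K ℚ.+ unit K`.
    q ℚ.- h , p<q , mk≲ (ℚₚ.≤-trans (s+u-nonNeg K) (s+u≤p K K≥M K≥N)) (K , λ n K≤n →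
      bound n (ℚₚ.≤-trans (s+u≤p n (ℕₚ.≤-trans K≥M K≤n) (ℕₚ.≤-trans K≥N K≤n)) ℚₚ.≤-refl))
    where
    open ℚₚ.≤-Reasoning
    h : ℚ
    h = ½ ℚ.* δ
    0<h : 0ℚ ℚ.< h
    0<h = half-pos 0<δ
    N K : ℕ
    N = proj₁ (archimedean h 0<h)
    K = M ⊔ N
    K≥M : M ≤ K
    K≥M = ℕₚ.m≤m⊔n M N
    K≥N : N ≤ K
    K≥N = ℕₚ.m≤n⊔m M N
    p<q : q ℚ.- h ℚ.< q
    p<q = subst (q ℚ.- h ℚ.<_) (ℚₚ.+-identityʳ q) (ℚₚ.+-monoʳ-< q (ℚₚ.neg-antimono-< 0<h))
    s : ℕ → ℚ
    s = seq ∣ z ∣ᶜ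
    s+u-nonNeg : ∀ n → 0ℚ ℚ.≤ s n ℚ.+ unit n
    s+u-nonNeg n = +-nonNeg (sqrtApprox-nonNeg n (seq (normSq z) n)) (ℚₚ.<⇒≤ (unit-pos n))
    s+u≤p : ∀ n → M ≤ n → N ≤ n → s n ℚ.+ unit n ℚ.≤ q ℚ.- h
    s+u≤p n M≤n N≤n = begin
      s n ℚ.+ unit n              ≤⟨ ℚₚ.+-monoʳ-≤ (s n) (proj₂ (archimedean h 0<h) n N≤n) ⟩
      s n ℚ.+ h                   ≡⟨ solve 2 (λ s h → s :+ h := (s :+ (h :+ h)) :+ :- h) refl (s n) h ⟩
      (s n ℚ.+ (h ℚ.+ h)) ℚ.- h   ≡⟨ cong (λ w → (s n ℚ.+ w) ℚ.- h) (half+half δ) ⟩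
      (s n ℚ.+ δ) ℚ.- h           ≤⟨ ℚₚ.+-monoˡ-≤ (ℚ.- h) (gap n M≤n) ⟩
      q ℚ.- h                     ∎
    bound : ∀ n → s n ℚ.+ unit n ℚ.≤ q ℚ.- h → seq (normSq z) n ℚ.≤ (q ℚ.- h) ℚ.* (q ℚ.- h)
    bound n le = ℚₚ.≤-trans (p≤∣p∣ (seq (normSq z) n)) (ℚₚ.≤-trans
      (ℚₚ.<⇒≤ (sqrtApprox-upper n (seq (normSq z) n))) (square-mono-≤ (s+u-nonNeg n) le))

  -- The square root is approximated from below, so no error has to be absorbed and the whole of e -
  -- p serves as the gap.
  ≲⇒∣∣ᶜ< : ∀ {z p e ε} → p ℚ.< e → Eventually (λ n → e ℚ.≤ seq ε n) → z ≲ p → ∣ z ∣ᶜ <ᴿ ε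
  ≲⇒∣∣ᶜ< {z} {p} {e} {ε} p<e e≤ε (mk≲ 0≤p zp) =
    e ℚ.- p , subst (ℚ._< e ℚ.- p) (ℚₚ.+-inverseʳ p) (ℚₚ.+-monoˡ-< (ℚ.- p) p<e)
    , eventually-map₂ le e≤ε zp
    where
    open ℚₚ.≤-Reasoning
    le : ∀ n → e ℚ.≤ seq ε n → seq (normSq z) n ℚ.≤ p ℚ.* p → seq ∣ z ∣ᶜ n ℚ.+ (e ℚ.- p) ℚ.≤ seq ε n
    le n e≤ z≤ = begin
      seq ∣ z ∣ᶜ n ℚ.+ (e ℚ.- p)
        ≤⟨ ℚₚ.+-monoˡ-≤ (e ℚ.- p) (square-cancel-≤ (seq ∣ z ∣ᶜ n) 0≤p (begin
             seq ∣ z ∣ᶜ n ℚ.* seq ∣ z ∣ᶜ n   ≤⟨ sqrtApprox-lower n (seq (normSq z) n) ⟩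
             ℚ.∣ seq (normSq z) n ∣
               ≡⟨ ℚₚ.0≤p⇒∣p∣≡p (+-nonNeg (square-nonNeg (seq (re z) n)) (square-nonNeg (seq (im z) n))) ⟩
             seq (normSq z) n                ≤⟨ z≤ ⟩
             p ℚ.* p                         ∎)) ⟩
      p ℚ.+ (e ℚ.- p)   ≡⟨ solve 2 (λ p e → p :+ (e :+ :- p) := e) refl p e ⟩
      e                 ≤⟨ e≤ ⟩
      seq ε n           ∎

  conjugate-inverse : ∀ a b r → r ℚ.* (a ℚ.* a ℚ.+ b ℚ.* b) ≡ 1ℚ →
    a ℚ.* (a ℚ.* r) ℚ.- b ℚ.* ((ℚ.- b) ℚ.* r) ≡ 1ℚ × a ℚ.* ((ℚ.- b) ℚ.* r) ℚ.+ b ℚ.* (a ℚ.* r) ≡ 0ℚ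
  conjugate-inverse a b r eq =
      trans (solve 3 (λ a b r → a :* (a :* r) :+ :- (b :* ((:- b) :* r)) := r :* (a :* a :+ b :* b)) refl a b r) eq
    , solve 3 (λ a b r → a :* ((:- b) :* r) :+ b :* (a :* r) := con 0ℚ) refl a b r

  -- The inverse is the conjugate over `normSq z`. The equation is exact once the approximants of
  -- `normSq z` stay above `q`; earlier ones may meet the junk value of `recip`, which is why `_≋_`
  -- asks for equality only eventually.
  *ᶜ-inverseʳ : ∀ z (z#0 : z #0) → z *ᶜ recipᶜ z z#0 ≋ 1ᶜ
  *ᶜ-inverseʳ z (q , 0<q , ev) = mk≋ (eventually-map
    (λ n le → conjugate-inverse (seq (re z) n) (seq (im z) n) (recip (seq (normSq z) n))
      (recip-inverse (ℚₚ.<-≤-trans 0<q (subst (ℚ._≤ seq (normSq z) n) (ℚₚ.+-identityˡ q) le)))) ev)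

  -- Since Re z ≤ ρ, the real part of 1 - z is at least 1 - ρ, and |1 - z| |w| = 1. The bound
  -- depends on `z` only through ρ, hence is uniform near a point of the disc.
  ≲-recip-1- : ∀ {z w ρ} → ρ ℚ.< 1ℚ → z ≲ ρ → (1ᶜ -ᶜ z) *ᶜ w ≋ 1ᶜ → w ≲ recip (1ℚ ℚ.- ρ)
  ≲-recip-1- {z} {w} {ρ} ρ<1 (mk≲ 0≤ρ zρ) (mk≋ e) =
    mk≲ (ℚₚ.<⇒≤ (recip-pos 0<σ)) (eventually-map₂ le zρ e)
    where
    open ℚₚ.≤-Reasoning
    σ : ℚ
    σ = 1ℚ ℚ.- ρ
    0<σ : 0ℚ ℚ.< σ
    0<σ = subst (ℚ._< σ) (ℚₚ.+-inverseʳ ρ) (ℚₚ.+-monoˡ-< (ℚ.- ρ) ρ<1)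
    le : ∀ n → seq (normSq z) n ℚ.≤ ρ ℚ.* ρ →
      seq (re ((1ᶜ -ᶜ z) *ᶜ w)) n ≡ 1ℚ × seq (im ((1ᶜ -ᶜ z) *ᶜ w)) n ≡ 0ℚ →
      seq (normSq w) n ℚ.≤ recip σ ℚ.* recip σ
    le n z≤ (re≡ , im≡) = ℚₚ.*-cancelˡ-≤-pos (σ ℚ.* σ) {{ℚ.positive (*-pos 0<σ 0<σ)}} (begin
      (σ ℚ.* σ) ℚ.* seq (normSq w) n
        ≤⟨ ℚₚ.*-monoʳ-≤-nonNeg (seq (normSq w) n) {{ℚ.nonNegative (+-nonNeg (square-nonNeg c) (square-nonNeg d))}} σσ≤ ⟩
      seq (normSq (1ᶜ -ᶜ z)) n ℚ.* seq (normSq w) n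
        ≡⟨ solve 4 (λ a b c d → (a :* a :+ b :* b) :* (c :* c :+ d :* d)
             := (a :* c :+ :- (b :* d)) :* (a :* c :+ :- (b :* d)) :+ (a :* d :+ b :* c) :* (a :* d :+ b :* c)) refl
             (1ℚ ℚ.- a) (0ℚ ℚ.- b) c d ⟩
      seq (normSq ((1ᶜ -ᶜ z) *ᶜ w)) n
        ≡⟨ cong₂ (λ x y → x ℚ.* x ℚ.+ y ℚ.* y) re≡ im≡ ⟩
      1ℚ ℚ.* 1ℚ
        ≡⟨ cong₂ ℚ._*_ (recip-inverse 0<σ) (recip-inverse 0<σ) ⟨
      (recip σ ℚ.* σ) ℚ.* (recip σ ℚ.* σ)
        ≡⟨ solve 2 (λ r s → (r :* s) :* (r :* s) := (s :* s) :* (r :* r)) refl (recip σ) σ ⟩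
      (σ ℚ.* σ) ℚ.* (recip σ ℚ.* recip σ) ∎)
      where
      a b c d : ℚ
      a = seq (re z) n
      b = seq (im z) n
      c = seq (re w) n
      d = seq (im w) n
      σσ≤ : σ ℚ.* σ ℚ.≤ seq (normSq (1ᶜ -ᶜ z)) n
      σσ≤ = ℚₚ.≤-trans
        (square-mono-≤ (ℚₚ.<⇒≤ 0<σ) (ℚₚ.+-monoʳ-≤ 1ℚ (ℚₚ.neg-antimono-≤
          (square-cancel-≤ a 0≤ρ (ℚₚ.≤-trans (p≤p+q (a ℚ.* a) (square-nonNeg b)) z≤)))))
        (p≤p+q ((1ℚ ℚ.- a) ℚ.* (1ℚ ℚ.- a)) (square-nonNeg (0ℚ ℚ.- b)))

≋⇒≈ᶜ : ∀ {z w} → z ≋ w → z ≈ᶜ w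
≋⇒≈ᶜ (mk≋ e) =
    (λ ε 0<ε → eventually-map (λ _ (p , _) → distance p 0<ε) e)
  , (λ ε 0<ε → eventually-map (λ _ (_ , p) → distance p 0<ε) e)
  where
  distance : ∀ {p q ε} → p ≡ q → 0ℚ ℚ.< ε → ℚ.∣ p ℚ.- q ∣ ℚ.< ε
  distance {p} refl 0<ε = subst (ℚ._< _) (sym (cong ℚ.∣_∣ (ℚₚ.+-inverseʳ p))) 0<ε

½-< : ∀ {e} → 0ℚ ℚ.< e → ½ ℚ.* e ℚ.< e
½-< {e} 0<e = subst₂ ℚ._<_ (ℚₚ.+-identityʳ (½ ℚ.* e)) (half+half e) (ℚₚ.+-monoʳ-< (½ ℚ.* e) (half-pos 0<e))

positive-lower-bound : ∀ {ε} → 0ᴿ <ᴿ ε → ∃[ e ] 0ℚ ℚ.< e × Eventually (λ n → e ℚ.≤ seq ε n)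
positive-lower-bound (e , 0<e , ev) = e , 0<e , eventually-map (λ _ → subst (ℚ._≤ _) (ℚₚ.+-identityˡ e)) ev

-- Null sequences

record Null (z : ℕ → ℂ) : Set where
  constructor mkNull
  field
    tends-to-0 : ∀ e → 0ℚ ℚ.< e → Eventually (λ n → z n ≲ e)

null-resp-≋ : ∀ {z w} → (∀ n → z n ≋ w n) → Null z → Null w
null-resp-≋ eq (mkNull f) = mkNull λ e 0<e → eventually-map (λ n → ≲-resp-≋ (eq n)) (f e 0<e)

null-+ : ∀ {z w} → Null z → Null w → Null (λ n → z n +ᶜ w n)
null-+ (mkNull f) (mkNull g) = mkNull λ e 0<e → eventually-map₂
  (λ n p q → ≲-mono (ℚₚ.≤-reflexive (half+half e)) (≲-+ p q)) (f _ (half-pos 0<e)) (g _ (half-pos 0<e))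

null-neg : ∀ {z} → Null z → Null (λ n → -ᶜ z n)
null-neg (mkNull f) = mkNull λ e 0<e → eventually-map (λ n → ≲-neg) (f e 0<e)

*-recip-cancel : ∀ {p} → 0ℚ ℚ.< p → ∀ q → p ℚ.* (recip p ℚ.* q) ≡ q
*-recip-cancel {p} 0<p q = begin
  p ℚ.* (recip p ℚ.* q)   ≡⟨ ℚₚ.*-assoc p (recip p) q ⟨
  p ℚ.* recip p ℚ.* q     ≡⟨ cong (ℚ._* q) (ℚₚ.*-comm p (recip p)) ⟩
  recip p ℚ.* p ℚ.* q     ≡⟨ cong (ℚ._* q) (recip-inverse 0<p) ⟩
  1ℚ ℚ.* q                ≡⟨ ℚₚ.*-identityˡ q ⟩
  q                       ∎
  where open ≡-Reasoning

null-*ˡ : ∀ c {z} → Null z → Null (λ n → c *ᶜ z n)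
null-*ˡ c {z} (mkNull f) = let M , 0<M , c≲M = ≲-exists c in mkNull λ e 0<e → eventually-map
  (λ n p → subst (c *ᶜ z n ≲_) (*-recip-cancel 0<M e) (≲-* c≲M p))
  (f (recip M ℚ.* e) (*-pos (recip-pos 0<M) 0<e))

-- The partial sums for `𝟙` and `x·` have a uniform description only from one summand on.
null-unshift : ∀ {z} → Null (λ n → z (suc n)) → Null z
null-unshift {z} (mkNull f) = mkNull λ e 0<e → let N , p = f e 0<e in
  suc N , λ { (suc n) (s≤s N≤n) → p n N≤n }

null-shift : ∀ {z} → Null z → Null (λ n → z (suc n))
null-shift {z} (mkNull f) = mkNull λ e 0<e → let N , p = f e 0<e in
  N , λ n N≤n → p (suc n) (ℕₚ.m≤n⇒m≤1+n N≤n)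

null⇒hasSum : ∀ {f s} → Null (λ n → ∑< n f -ᶜ s) → HasSum f s
null⇒hasSum (mkNull g) ε 0<ε =
  let e , 0<e , ev = positive-lower-bound {ε} 0<ε
  in eventually-map (λ n → ≲⇒∣∣ᶜ< {ε = ε} (½-< 0<e) ev) (g (½ ℚ.* e) (half-pos 0<e))

-- Power series with natural coefficients

∑ℕ : ℕ → (ℕ → ℕ) → ℕ
∑ℕ zero    f = 0
∑ℕ (suc n) f = ∑ℕ n f + f n

infixr 8 x·_ u·_
infixr 7 _⊙_
infixl 6 _⊕_

-- x· e and u· e denote y e(y) and e(y) / (1 - y).
data Term : Set where
  𝟘 𝟙   : Term
  x·_   : Term → Term
  u·_   : Term → Term
  _⊕_   : Term → Term → Term
  _⊙_   : ℕ → Term → Term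

⟦_⟧ : Term → Disc → ℂ
⟦ 𝟘 ⟧      y = 0ᶜ
⟦ 𝟙 ⟧      y = 1ᶜ
⟦ x· e ⟧   y = pt y *ᶜ ⟦ e ⟧ y
⟦ u· e ⟧   y = (1/1- y) *ᶜ ⟦ e ⟧ y
⟦ e ⊕ e′ ⟧ y = ⟦ e ⟧ y +ᶜ ⟦ e′ ⟧ y
⟦ c ⊙ e ⟧  y = ℕ→ℂ c *ᶜ ⟦ e ⟧ y

coef : Term → ℕ → ℕ
coef 𝟘        k       = 0
coef 𝟙        zero    = 1
coef 𝟙        (suc k) = 0
coef (x· e)   zero    = 0
coef (x· e)   (suc k) = coef e k
coef (u· e)   k       = ∑ℕ (suc k) (coef e)
coef (e ⊕ e′) k       = coef e k + coef e′ k
coef (c ⊙ e)  k       = c * coef e k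

-- The `u·` clause is the product rule with (1/(1 - y))' = 1/(1 - y)², so the syntax is closed under
-- differentiation.
∂ : Term → Term
∂ 𝟘        = 𝟘
∂ 𝟙        = 𝟘
∂ (x· e)   = e ⊕ x· ∂ e
∂ (u· e)   = u· u· e ⊕ u· ∂ e
∂ (e ⊕ e′) = ∂ e ⊕ ∂ e′
∂ (c ⊙ e)  = c ⊙ ∂ e

∑ℕ-cong : ∀ n {f g} → (∀ k → f k ≡ g k) → ∑ℕ n f ≡ ∑ℕ n g
∑ℕ-cong zero    eq = refl
∑ℕ-cong (suc n) eq = cong₂ _+_ (∑ℕ-cong n eq) (eq n)

module _ where
  open ℕSolver.+-*-Solver using (solve; _:=_; _:+_; _:*_; con)

  -- For j ≤ k + 1, the value `f j` is counted k + 1 - j times in the first sum and j times in the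
  -- second. This is the `u·` clause of `∂` read on coefficients.
  ∑ℕ-∂ : ∀ f k →
    ∑ℕ (suc k) (λ i → ∑ℕ (suc i) f) + ∑ℕ (suc k) (λ i → suc i * f (suc i)) ≡ suc k * ∑ℕ (suc (suc k)) f
  ∑ℕ-∂ f zero    = solve 2 (λ a b → a :+ (con 1 :* b) := con 1 :* (a :+ b)) refl (f 0) (f 1)
  ∑ℕ-∂ f (suc k) = begin
    (a + s) + (b + suc (suc k) * f (suc (suc k)))
      ≡⟨ solve 5 (λ a b s k t → (a :+ s) :+ (b :+ (con 2 :+ k) :* t) := (a :+ b) :+ (s :+ (con 2 :+ k) :* t)) refl a b s k (f (suc (suc k))) ⟩
    (a + b) + (s + suc (suc k) * f (suc (suc k)))
      ≡⟨ cong (_+ (s + suc (suc k) * f (suc (suc k)))) (∑ℕ-∂ f k) ⟩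
    suc k * s + (s + suc (suc k) * f (suc (suc k)))
      ≡⟨ solve 3 (λ k s t → (con 1 :+ k) :* s :+ (s :+ (con 2 :+ k) :* t) := (con 2 :+ k) :* (s :+ t)) refl k s (f (suc (suc k))) ⟩
    suc (suc k) * (s + f (suc (suc k))) ∎
    where
    open ≡-Reasoning
    a b s : ℕ
    a = ∑ℕ (suc k) (λ i → ∑ℕ (suc i) f)
    b = ∑ℕ (suc k) (λ i → suc i * f (suc i))
    s = ∑ℕ (suc (suc k)) f

  coef-∂ : ∀ e k → coef (∂ e) k ≡ suc k * coef e (suc k)
  coef-∂ 𝟘        k       = sym (ℕₚ.*-zeroʳ (suc k))
  coef-∂ 𝟙        k       = sym (ℕₚ.*-zeroʳ (suc k))
  coef-∂ (x· e)   zero    = refl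
  coef-∂ (x· e)   (suc k) = cong (coef e (suc k) +_) (coef-∂ e k)
  coef-∂ (u· e)   k       = trans (cong (coef (u· u· e) k +_) (∑ℕ-cong (suc k) (coef-∂ e))) (∑ℕ-∂ (coef e) k)
  coef-∂ (e ⊕ e′) k       = trans (cong₂ _+_ (coef-∂ e k) (coef-∂ e′ k))
    (sym (ℕₚ.*-distribˡ-+ (suc k) (coef e (suc k)) (coef e′ (suc k))))
  coef-∂ (c ⊙ e)  k       = trans (cong (c *_) (coef-∂ e k))
    (solve 3 (λ c s t → c :* (s :* t) := s :* (c :* t)) refl c (suc k) (coef e (suc k)))

-- Rational majorants of power series

module _ where
  open ℚSolver.+-*-Solver using (solve; _:=_; _:+_; _:*_; :-_; con)
  open ≡-Reasoning

  fromℕ-+ : ∀ m n → fromℕ (m + n) ≡ fromℕ m ℚ.+ fromℕ n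
  fromℕ-+ zero    n = sym (trans (cong (ℚ._+ fromℕ n) fromℕ-zero) (ℚₚ.+-identityˡ (fromℕ n)))
  fromℕ-+ (suc m) n = begin
    fromℕ (suc (m + n))             ≡⟨ fromℕ-suc (m + n) ⟩
    fromℕ (m + n) ℚ.+ 1ℚ            ≡⟨ cong (ℚ._+ 1ℚ) (fromℕ-+ m n) ⟩
    (fromℕ m ℚ.+ fromℕ n) ℚ.+ 1ℚ    ≡⟨ solve 2 (λ a b → (a :+ b) :+ con 1ℚ := (a :+ con 1ℚ) :+ b) refl (fromℕ m) (fromℕ n) ⟩
    (fromℕ m ℚ.+ 1ℚ) ℚ.+ fromℕ n    ≡⟨ cong (ℚ._+ fromℕ n) (fromℕ-suc m) ⟨
    fromℕ (suc m) ℚ.+ fromℕ n       ∎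

  fromℕ-* : ∀ m n → fromℕ (m * n) ≡ fromℕ m ℚ.* fromℕ n
  fromℕ-* zero    n = trans fromℕ-zero (sym (trans (cong (ℚ._* fromℕ n) fromℕ-zero) (ℚₚ.*-zeroˡ (fromℕ n))))
  fromℕ-* (suc m) n = begin
    fromℕ (n + m * n)                       ≡⟨ fromℕ-+ n (m * n) ⟩
    fromℕ n ℚ.+ fromℕ (m * n)               ≡⟨ cong (fromℕ n ℚ.+_) (fromℕ-* m n) ⟩
    fromℕ n ℚ.+ fromℕ m ℚ.* fromℕ n         ≡⟨ solve 2 (λ a b → b :+ a :* b := (a :+ con 1ℚ) :* b) refl (fromℕ m) (fromℕ n) ⟩
    (fromℕ m ℚ.+ 1ℚ) ℚ.* fromℕ n            ≡⟨ cong (ℚ._* fromℕ n) (fromℕ-suc m) ⟨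
    fromℕ (suc m) ℚ.* fromℕ n               ∎

  fromℕ-one : fromℕ 1 ≡ 1ℚ
  fromℕ-one = trans (fromℕ-suc 0) (trans (cong (ℚ._+ 1ℚ) fromℕ-zero) (ℚₚ.+-identityˡ 1ℚ))

  fromℕ-mono-≤ : ∀ {m n} → m ≤ n → fromℕ m ℚ.≤ fromℕ n
  fromℕ-mono-≤ {m} {n} m≤n = subst (fromℕ m ℚ.≤_)
    (trans (sym (fromℕ-+ m (n ∸ m))) (cong fromℕ (ℕₚ.m+[n∸m]≡n m≤n)))
    (p≤p+q (fromℕ m) (fromℕ-nonNeg (n ∸ m)))

  -- Its purpose is to bound single terms: for ρ ≥ 0 all summands are nonnegative, so each is at
  -- most any bound of the sums.
  weightedSum : ℚ → (ℕ → ℕ) → ℕ → ℚ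
  weightedSum ρ f zero    = 0ℚ
  weightedSum ρ f (suc n) = weightedSum ρ f n ℚ.+ fromℕ (f n) ℚ.* ρ ^ℚ n

  weightedSum-𝟘 : ∀ ρ n → weightedSum ρ (coef 𝟘) n ≡ 0ℚ
  weightedSum-𝟘 ρ zero    = refl
  weightedSum-𝟘 ρ (suc n) = begin
    weightedSum ρ (coef 𝟘) n ℚ.+ fromℕ 0 ℚ.* ρ ^ℚ n
      ≡⟨ cong₂ (λ a b → a ℚ.+ b ℚ.* ρ ^ℚ n) (weightedSum-𝟘 ρ n) fromℕ-zero ⟩
    0ℚ ℚ.+ 0ℚ ℚ.* ρ ^ℚ n
      ≡⟨ solve 1 (λ r → con 0ℚ :+ con 0ℚ :* r := con 0ℚ) refl (ρ ^ℚ n) ⟩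
    0ℚ ∎

  weightedSum-x : ∀ ρ e n → weightedSum ρ (coef (x· e)) (suc n) ≡ ρ ℚ.* weightedSum ρ (coef e) n
  weightedSum-x ρ e zero    = trans (cong (λ z → 0ℚ ℚ.+ z ℚ.* 1ℚ) fromℕ-zero)
    (solve 1 (λ r → con 0ℚ :+ con 0ℚ :* con 1ℚ := r :* con 0ℚ) refl ρ)
  weightedSum-x ρ e (suc n) = begin
    weightedSum ρ (coef (x· e)) (suc n) ℚ.+ fromℕ (coef e n) ℚ.* (ρ ℚ.* ρ ^ℚ n)
      ≡⟨ cong (ℚ._+ fromℕ (coef e n) ℚ.* (ρ ℚ.* ρ ^ℚ n)) (weightedSum-x ρ e n) ⟩
    ρ ℚ.* weightedSum ρ (coef e) n ℚ.+ fromℕ (coef e n) ℚ.* (ρ ℚ.* ρ ^ℚ n)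
      ≡⟨ solve 4 (λ r w c s → r :* w :+ c :* (r :* s) := r :* (w :+ c :* s)) refl ρ (weightedSum ρ (coef e) n) (fromℕ (coef e n)) (ρ ^ℚ n) ⟩
    ρ ℚ.* (weightedSum ρ (coef e) n ℚ.+ fromℕ (coef e n) ℚ.* ρ ^ℚ n) ∎

  weightedSum-𝟙 : ∀ ρ n → weightedSum ρ (coef 𝟙) (suc n) ≡ 1ℚ
  weightedSum-𝟙 ρ zero    = cong (λ z → 0ℚ ℚ.+ z ℚ.* 1ℚ) fromℕ-one
  weightedSum-𝟙 ρ (suc n) = begin
    weightedSum ρ (coef 𝟙) (suc n) ℚ.+ fromℕ 0 ℚ.* (ρ ^ℚ suc n)
      ≡⟨ cong₂ (λ a b → a ℚ.+ b ℚ.* (ρ ^ℚ suc n)) (weightedSum-𝟙 ρ n) fromℕ-zero ⟩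
    1ℚ ℚ.+ 0ℚ ℚ.* (ρ ^ℚ suc n)
      ≡⟨ solve 1 (λ r → con 1ℚ :+ con 0ℚ :* r := con 1ℚ) refl (ρ ^ℚ suc n) ⟩
    1ℚ ∎

  -- Multiplication by 1 - ρ telescopes the partial sums of the coefficients. The boundary term is
  -- added on the left, so that dropping it yields an upper bound.
  weightedSum-u : ∀ ρ e n → (1ℚ ℚ.- ρ) ℚ.* weightedSum ρ (coef (u· e)) n ℚ.+ fromℕ (∑ℕ n (coef e)) ℚ.* ρ ^ℚ n
    ≡ weightedSum ρ (coef e) n
  weightedSum-u ρ e zero    = trans (cong (λ z → (1ℚ ℚ.- ρ) ℚ.* 0ℚ ℚ.+ z ℚ.* 1ℚ) fromℕ-zero)
    (solve 1 (λ r → (con 1ℚ :+ :- r) :* con 0ℚ :+ con 0ℚ :* con 1ℚ := con 0ℚ) refl ρ)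
  weightedSum-u ρ e (suc n) = begin
    (1ℚ ℚ.- ρ) ℚ.* (w ℚ.+ fromℕ (s + c) ℚ.* r) ℚ.+ fromℕ (s + c) ℚ.* (ρ ℚ.* r)
      ≡⟨ cong (λ z → (1ℚ ℚ.- ρ) ℚ.* (w ℚ.+ z ℚ.* r) ℚ.+ z ℚ.* (ρ ℚ.* r)) (fromℕ-+ s c) ⟩
    (1ℚ ℚ.- ρ) ℚ.* (w ℚ.+ (fromℕ s ℚ.+ fromℕ c) ℚ.* r) ℚ.+ (fromℕ s ℚ.+ fromℕ c) ℚ.* (ρ ℚ.* r)
      ≡⟨ solve 5 (λ p w s c r → (con 1ℚ :+ :- p) :* (w :+ (s :+ c) :* r) :+ (s :+ c) :* (p :* r)
           := ((con 1ℚ :+ :- p) :* w :+ s :* r) :+ c :* r) refl ρ w (fromℕ s) (fromℕ c) r ⟩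
    ((1ℚ ℚ.- ρ) ℚ.* w ℚ.+ fromℕ s ℚ.* r) ℚ.+ fromℕ c ℚ.* r
      ≡⟨ cong (ℚ._+ fromℕ c ℚ.* r) (weightedSum-u ρ e n) ⟩
    weightedSum ρ (coef e) n ℚ.+ fromℕ c ℚ.* r ∎
    where
    w r : ℚ
    w = weightedSum ρ (coef (u· e)) n
    r = ρ ^ℚ n
    s c : ℕ
    s = ∑ℕ n (coef e)
    c = coef e n

  weightedSum-⊕ : ∀ ρ e e′ n → weightedSum ρ (coef (e ⊕ e′)) n ≡ weightedSum ρ (coef e) n ℚ.+ weightedSum ρ (coef e′) n
  weightedSum-⊕ ρ e e′ zero    = refl
  weightedSum-⊕ ρ e e′ (suc n) = trans
    (cong₂ (λ a b → a ℚ.+ b ℚ.* ρ ^ℚ n) (weightedSum-⊕ ρ e e′ n) (fromℕ-+ (coef e n) (coef e′ n)))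
    (solve 5 (λ a b c d r → (a :+ b) :+ (c :+ d) :* r := (a :+ c :* r) :+ (b :+ d :* r)) refl
      (weightedSum ρ (coef e) n) (weightedSum ρ (coef e′) n) (fromℕ (coef e n)) (fromℕ (coef e′ n)) (ρ ^ℚ n))

  weightedSum-⊙ : ∀ ρ c e n → weightedSum ρ (coef (c ⊙ e)) n ≡ fromℕ c ℚ.* weightedSum ρ (coef e) n
  weightedSum-⊙ ρ c e zero    = sym (ℚₚ.*-zeroʳ (fromℕ c))
  weightedSum-⊙ ρ c e (suc n) = trans
    (cong₂ (λ a b → a ℚ.+ b ℚ.* ρ ^ℚ n) (weightedSum-⊙ ρ c e n) (fromℕ-* c (coef e n)))
    (solve 4 (λ c w d r → c :* w :+ (c :* d) :* r := c :* (w :+ d :* r)) refl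
      (fromℕ c) (weightedSum ρ (coef e) n) (fromℕ (coef e n)) (ρ ^ℚ n))

module _ {ρ : ℚ} (0≤ρ : 0ℚ ℚ.≤ ρ) (ρ<1 : ρ ℚ.< 1ℚ) where
  open ℚₚ.≤-Reasoning

  private
    σ : ℚ
    σ = 1ℚ ℚ.- ρ
    0<σ : 0ℚ ℚ.< σ
    0<σ = subst (ℚ._< σ) (ℚₚ.+-inverseʳ ρ) (ℚₚ.+-monoˡ-< (ℚ.- ρ) ρ<1)

  ^ℚ-nonNeg : ∀ n → 0ℚ ℚ.≤ ρ ^ℚ n
  ^ℚ-nonNeg zero    = ℚₚ.<⇒≤ (ℚₚ.positive⁻¹ 1ℚ)
  ^ℚ-nonNeg (suc n) = *-nonNeg 0≤ρ (^ℚ-nonNeg n)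

  weightedTerm-nonNeg : ∀ m n → 0ℚ ℚ.≤ fromℕ m ℚ.* ρ ^ℚ n
  weightedTerm-nonNeg m n = *-nonNeg (fromℕ-nonNeg m) (^ℚ-nonNeg n)

  weightedSum-nonNeg : ∀ f n → 0ℚ ℚ.≤ weightedSum ρ f n
  weightedSum-nonNeg f zero    = ℚₚ.≤-refl
  weightedSum-nonNeg f (suc n) = +-nonNeg (weightedSum-nonNeg f n) (weightedTerm-nonNeg (f n) n)

  weightedSum-bounded : ∀ e → ∃[ K ] 0ℚ ℚ.< K × (∀ n → weightedSum ρ (coef e) n ℚ.≤ K)
  weightedSum-bounded 𝟘 = 1ℚ , ℚₚ.positive⁻¹ 1ℚ , λ n →
    ℚₚ.≤-trans (ℚₚ.≤-reflexive (weightedSum-𝟘 ρ n)) (ℚₚ.<⇒≤ (ℚₚ.positive⁻¹ 1ℚ))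
  weightedSum-bounded 𝟙 = 1ℚ , ℚₚ.positive⁻¹ 1ℚ , λ where
    zero    → ℚₚ.<⇒≤ (ℚₚ.positive⁻¹ 1ℚ)
    (suc n) → ℚₚ.≤-reflexive (weightedSum-𝟙 ρ n)
  weightedSum-bounded (x· e) = let K , 0<K , w≤K = weightedSum-bounded e in
    K , 0<K , λ where
      zero    → ℚₚ.<⇒≤ 0<K
      (suc n) → begin
        weightedSum ρ (coef (x· e)) (suc n)   ≡⟨ weightedSum-x ρ e n ⟩
        ρ ℚ.* weightedSum ρ (coef e) n        ≤⟨ *-mono-≤ 0≤ρ (ℚₚ.<⇒≤ 0<K) (ℚₚ.<⇒≤ ρ<1) (w≤K n) ⟩
        1ℚ ℚ.* K                              ≡⟨ ℚₚ.*-identityˡ K ⟩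
        K                                     ∎
  weightedSum-bounded (u· e) = let K , 0<K , w≤K = weightedSum-bounded e in
    recip σ ℚ.* K , *-pos (recip-pos 0<σ) 0<K , λ n → ℚₚ.*-cancelˡ-≤-pos σ {{ℚ.positive 0<σ}} (begin
      σ ℚ.* weightedSum ρ (coef (u· e)) n
        ≤⟨ p≤p+q _ (weightedTerm-nonNeg (∑ℕ n (coef e)) n) ⟩
      σ ℚ.* weightedSum ρ (coef (u· e)) n ℚ.+ fromℕ (∑ℕ n (coef e)) ℚ.* ρ ^ℚ n
        ≡⟨ weightedSum-u ρ e n ⟩
      weightedSum ρ (coef e) n   ≤⟨ w≤K n ⟩
      K                          ≡⟨ *-recip-cancel 0<σ K ⟨
      σ ℚ.* (recip σ ℚ.* K)      ∎)
  weightedSum-bounded (e ⊕ e′) =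
    let K  , 0<K  , w≤K  = weightedSum-bounded e
        K′ , 0<K′ , w≤K′ = weightedSum-bounded e′
    in K ℚ.+ K′ , ℚₚ.+-mono-< 0<K 0<K′ , λ n →
      ℚₚ.≤-trans (ℚₚ.≤-reflexive (weightedSum-⊕ ρ e e′ n)) (ℚₚ.+-mono-≤ (w≤K n) (w≤K′ n))
  weightedSum-bounded (c ⊙ e) = let K , 0<K , w≤K = weightedSum-bounded e in
    -- The extra `K` keeps the bound positive when `c` is 0.
    fromℕ c ℚ.* K ℚ.+ K , ℚₚ.+-mono-≤-< (*-nonNeg (fromℕ-nonNeg c) (ℚₚ.<⇒≤ 0<K)) 0<K , λ n → begin
      weightedSum ρ (coef (c ⊙ e)) n         ≡⟨ weightedSum-⊙ ρ c e n ⟩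
      fromℕ c ℚ.* weightedSum ρ (coef e) n   ≤⟨ ℚₚ.*-monoˡ-≤-nonNeg (fromℕ c) {{ℚ.nonNegative (fromℕ-nonNeg c)}} (w≤K n) ⟩
      fromℕ c ℚ.* K                          ≤⟨ p≤p+q _ (ℚₚ.<⇒≤ 0<K) ⟩
      fromℕ c ℚ.* K ℚ.+ K                    ∎

  -- The factor unit n is gained from the bound for (y e(y))′, whose coefficients are (n + 1) coef e n.
  weightedTerm-bounded : ∀ e → ∃[ K ] 0ℚ ℚ.< K × (∀ n → fromℕ (coef e n) ℚ.* ρ ^ℚ n ℚ.≤ K ℚ.* unit n)
  weightedTerm-bounded e = let K , 0<K , w≤K = weightedSum-bounded (∂ (x· e)) in
    K , 0<K , λ n → begin
      fromℕ (coef e n) ℚ.* ρ ^ℚ n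
        ≡⟨ ℚₚ.*-identityʳ _ ⟨
      fromℕ (coef e n) ℚ.* ρ ^ℚ n ℚ.* 1ℚ
        ≡⟨ cong (fromℕ (coef e n) ℚ.* ρ ^ℚ n ℚ.*_) (unit-inverse n) ⟨
      fromℕ (coef e n) ℚ.* ρ ^ℚ n ℚ.* (fromℕ (suc n) ℚ.* unit n)
        ≡⟨ regroup (fromℕ (coef e n)) (ρ ^ℚ n) (fromℕ (suc n)) (unit n) ⟩
      fromℕ (suc n) ℚ.* fromℕ (coef e n) ℚ.* ρ ^ℚ n ℚ.* unit n
        ≡⟨ cong (λ z → z ℚ.* ρ ^ℚ n ℚ.* unit n) (fromℕ-* (suc n) (coef e n)) ⟨
      fromℕ (suc n * coef e n) ℚ.* ρ ^ℚ n ℚ.* unit n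
        ≡⟨ cong (λ z → fromℕ z ℚ.* ρ ^ℚ n ℚ.* unit n) (coef-∂ (x· e) n) ⟨
      fromℕ (coef (∂ (x· e)) n) ℚ.* ρ ^ℚ n ℚ.* unit n
        ≤⟨ ℚₚ.*-monoʳ-≤-nonNeg (unit n) {{ℚ.nonNegative (ℚₚ.<⇒≤ (unit-pos n))}} (begin
             t n                                       ≡⟨ ℚₚ.+-identityˡ (t n) ⟨
             0ℚ ℚ.+ t n                                ≤⟨ ℚₚ.+-monoˡ-≤ (t n) (weightedSum-nonNeg (coef (∂ (x· e))) n) ⟩
             weightedSum ρ (coef (∂ (x· e))) (suc n)   ≤⟨ w≤K (suc n) ⟩
             K                                         ∎) ⟩
      K ℚ.* unit n ∎
    where
    t : ℕ → ℚ
    t n = fromℕ (coef (∂ (x· e)) n) ℚ.* ρ ^ℚ n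
    regroup : ∀ c r s v → c ℚ.* r ℚ.* (s ℚ.* v) ≡ s ℚ.* c ℚ.* r ℚ.* v
    regroup = solve 4 (λ c r s v → c :* r :* (s :* v) := s :* c :* r :* v) refl
      where open ℚSolver.+-*-Solver using (solve; _:=_; _:*_)

disc-bound : ∀ (x : Disc) → ∃[ ρ ] ρ ℚ.< 1ℚ × pt x ≲ ρ
disc-bound x = ∣∣ᶜ<⇒≲ {pt x} (pt<1 x)

≲-^ : ∀ {z ρ} → z ≲ ρ → ∀ n → z ^ᶜ n ≲ ρ ^ℚ n
≲-^ z≲ρ zero    = ≲-ℚ→ℂ (ℚₚ.<⇒≤ (ℚₚ.positive⁻¹ 1ℚ))
≲-^ z≲ρ (suc n) = ≲-* z≲ρ (≲-^ z≲ρ n)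

-- The terms are at most K/(n+1) in absolute value, which the Archimedean property makes small.
-- Since `g` need only lie below the coefficients of a term, boundary terms with other coefficients
-- are covered too.
null-dominated : ∀ x e {g : ℕ → ℕ} → (∀ n → g n ≤ coef e n) → Null (λ n → ℕ→ℂ (g n) *ᶜ pt x ^ᶜ n)
null-dominated x e {g} g≤ =
  let ρ , ρ<1 , x≲ρ = disc-bound x
      0≤ρ           = bound-nonNeg x≲ρ
      K , 0<K , c≤  = weightedTerm-bounded 0≤ρ ρ<1 e
  in mkNull λ ε 0<ε →
  let N , small = archimedean (recip K ℚ.* ε) (*-pos (recip-pos 0<K) 0<ε)
  in N , λ n N≤n → ≲-mono
    (ℚₚ.≤-trans (ℚₚ.*-monoʳ-≤-nonNeg (ρ ^ℚ n) {{ℚ.nonNegative (^ℚ-nonNeg 0≤ρ ρ<1 n)}} (fromℕ-mono-≤ (g≤ n)))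
    (ℚₚ.≤-trans (c≤ n)
    (ℚₚ.≤-trans (ℚₚ.*-monoˡ-≤-nonNeg K {{ℚ.nonNegative (ℚₚ.<⇒≤ 0<K)}} (small n N≤n))
    (ℚₚ.≤-reflexive (*-recip-cancel 0<K ε)))))
    (≲-* (≲-ℚ→ℂ (fromℕ-nonNeg (g n))) (≲-^ x≲ρ n))

-- Partial sums of power series and their limits

module ≋-Reasoning = Relation.Binary.Reasoning.Setoid ≋-setoid

ℕ→ℂ-+ : ∀ m n → ℕ→ℂ (m + n) ≋ ℕ→ℂ m +ᶜ ℕ→ℂ n
ℕ→ℂ-+ m n = ≋-trans (≋-reflexive (cong ℚ→ℂ (fromℕ-+ m n))) (ℚ→ℂ-+ (fromℕ m) (fromℕ n))

ℕ→ℂ-* : ∀ m n → ℕ→ℂ (m * n) ≋ ℕ→ℂ m *ᶜ ℕ→ℂ n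
ℕ→ℂ-* m n = ≋-trans (≋-reflexive (cong ℚ→ℂ (fromℕ-* m n))) (ℚ→ℂ-* (fromℕ m) (fromℕ n))

ℕ→ℂ-zero : ℕ→ℂ 0 ≋ 0ᶜ
ℕ→ℂ-zero = ≋-reflexive (cong ℚ→ℂ fromℕ-zero)

ℕ→ℂ-one : ℕ→ℂ 1 ≋ 1ᶜ
ℕ→ℂ-one = ≋-reflexive (cong ℚ→ℂ fromℕ-one)

1-x-inverse : ∀ x → (1ᶜ -ᶜ pt x) *ᶜ (1/1- x) ≋ 1ᶜ
1-x-inverse x = *ᶜ-inverseʳ (1ᶜ -ᶜ pt x) (1-x#0 x)

module _ where
  open ≋-Reasoning
  open ≋-Solver using (solve; _:=_; _:+_; _:*_; _:-_; con)

  -- `∑<` unfolds at its first summand, while induction on partial sums appends at the end.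
  ∑<-last : ∀ n f → ∑< (suc n) f ≋ ∑< n f +ᶜ f n
  ∑<-last zero    f = solve 1 (λ a → a :+ con 0ℚ := con 0ℚ :+ a) ≋-refl (f 0)
  ∑<-last (suc n) f = begin
    f 0 +ᶜ ∑< (suc n) (λ k → f (suc k))
      ≈⟨ +ᶜ-cong ≋-refl (∑<-last n (λ k → f (suc k))) ⟩
    f 0 +ᶜ (∑< n (λ k → f (suc k)) +ᶜ f (suc n))
      ≈⟨ solve 3 (λ a b c → a :+ (b :+ c) := (a :+ b) :+ c) ≋-refl (f 0) (∑< n (λ k → f (suc k))) (f (suc n)) ⟩
    ∑< (suc n) f +ᶜ f (suc n) ∎

  ∑<-cong : ∀ n {f g} → (∀ k → f k ≋ g k) → ∑< n f ≋ ∑< n g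
  ∑<-cong zero    eq = ≋-refl
  ∑<-cong (suc n) eq = +ᶜ-cong (eq 0) (∑<-cong n (λ k → eq (suc k)))

  ∑<-+ : ∀ n f g → ∑< n (λ k → f k +ᶜ g k) ≋ ∑< n f +ᶜ ∑< n g
  ∑<-+ zero    f g = ≋-sym (+ᶜ-identityˡ 0ᶜ)
  ∑<-+ (suc n) f g = ≋-trans (+ᶜ-cong ≋-refl (∑<-+ n (λ k → f (suc k)) (λ k → g (suc k))))
    (solve 4 (λ a b c d → (a :+ b) :+ (c :+ d) := (a :+ c) :+ (b :+ d)) ≋-refl
      (f 0) (g 0) (∑< n (λ k → f (suc k))) (∑< n (λ k → g (suc k))))

  ∑<-*ˡ : ∀ c n f → ∑< n (λ k → c *ᶜ f k) ≋ c *ᶜ ∑< n f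
  ∑<-*ˡ c zero    f = solve 1 (λ c → con 0ℚ := c :* con 0ℚ) ≋-refl c
  ∑<-*ˡ c (suc n) f = ≋-trans (+ᶜ-cong ≋-refl (∑<-*ˡ c n (λ k → f (suc k))))
    (solve 3 (λ c a b → c :* a :+ c :* b := c :* (a :+ b)) ≋-refl c (f 0) (∑< n (λ k → f (suc k))))

  monomial : (ℕ → ℕ) → ℂ → ℕ → ℂ
  monomial f z k = ℕ→ℂ (f k) *ᶜ z ^ᶜ k

  partialSum : (ℕ → ℕ) → ℂ → ℕ → ℂ
  partialSum f z n = ∑< n (monomial f z)

  partialSum-cong : ∀ n {f g} z → (∀ k → f k ≡ g k) → partialSum f z n ≋ partialSum g z n
  partialSum-cong n z eq = ∑<-cong n (λ k → ≋-reflexive (cong (λ m → ℕ→ℂ m *ᶜ z ^ᶜ k) (eq k)))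

  partialSum-+ : ∀ f g z n → partialSum (λ k → f k + g k) z n ≋ partialSum f z n +ᶜ partialSum g z n
  partialSum-+ f g z n = ≋-trans
    (∑<-cong n (λ k → ≋-trans (*ᶜ-cong (ℕ→ℂ-+ (f k) (g k)) ≋-refl)
      (solve 3 (λ a b c → (a :+ b) :* c := a :* c :+ b :* c) ≋-refl (ℕ→ℂ (f k)) (ℕ→ℂ (g k)) (z ^ᶜ k))))
    (∑<-+ n (monomial f z) (monomial g z))

  partialSum-* : ∀ c f z n → partialSum (λ k → c * f k) z n ≋ ℕ→ℂ c *ᶜ partialSum f z n
  partialSum-* c f z n = ≋-trans
    (∑<-cong n (λ k → ≋-trans (*ᶜ-cong (ℕ→ℂ-* c (f k)) ≋-refl)
      (solve 3 (λ a b c → (a :* b) :* c := a :* (b :* c)) ≋-refl (ℕ→ℂ c) (ℕ→ℂ (f k)) (z ^ᶜ k))))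
    (∑<-*ˡ (ℕ→ℂ c) n (monomial f z))

  partialSum-zero : ∀ z n → partialSum (λ _ → 0) z n ≋ 0ᶜ
  partialSum-zero z n = begin
    partialSum (λ _ → 0) z n              ≈⟨ partialSum-* 0 (λ _ → 0) z n ⟩
    ℕ→ℂ 0 *ᶜ partialSum (λ _ → 0) z n     ≈⟨ *ᶜ-cong ℕ→ℂ-zero ≋-refl ⟩
    0ᶜ *ᶜ partialSum (λ _ → 0) z n        ≈⟨ solve 1 (λ a → con 0ℚ :* a := con 0ℚ) ≋-refl (partialSum (λ _ → 0) z n) ⟩
    0ᶜ                                    ∎

  ∑<-zero : ∀ n {f} → (∀ k → f k ≋ 0ᶜ) → ∑< n f ≋ 0ᶜ
  ∑<-zero zero    eq = ≋-refl
  ∑<-zero (suc n) eq = ≋-trans (+ᶜ-cong (eq 0) (∑<-zero n (λ k → eq (suc k)))) (+ᶜ-identityˡ 0ᶜ)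

  partialSum-𝟙 : ∀ z n → partialSum (coef 𝟙) z (suc n) ≋ 1ᶜ
  partialSum-𝟙 z n = begin
    ℕ→ℂ 1 *ᶜ 1ᶜ +ᶜ ∑< n (λ k → monomial (coef 𝟙) z (suc k))
      ≈⟨ +ᶜ-cong (*ᶜ-cong ℕ→ℂ-one ≋-refl) (∑<-zero n (λ k → ≋-trans (*ᶜ-cong ℕ→ℂ-zero ≋-refl)
           (solve 1 (λ a → con 0ℚ :* a := con 0ℚ) ≋-refl (z ^ᶜ suc k)))) ⟩
    1ᶜ *ᶜ 1ᶜ +ᶜ 0ᶜ
      ≈⟨ solve 0 (con 1ℚ :* con 1ℚ :+ con 0ℚ := con 1ℚ) ≋-refl ⟩
    1ᶜ ∎

  partialSum-x : ∀ e z n → partialSum (coef (x· e)) z (suc n) ≋ z *ᶜ partialSum (coef e) z n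
  partialSum-x e z n = begin
    ℕ→ℂ 0 *ᶜ 1ᶜ +ᶜ ∑< n (λ k → ℕ→ℂ (coef e k) *ᶜ (z *ᶜ z ^ᶜ k))
      ≈⟨ +ᶜ-cong (*ᶜ-cong ℕ→ℂ-zero ≋-refl) (∑<-cong n (λ k →
           solve 3 (λ a z b → a :* (z :* b) := z :* (a :* b)) ≋-refl (ℕ→ℂ (coef e k)) z (z ^ᶜ k))) ⟩
    0ᶜ *ᶜ 1ᶜ +ᶜ ∑< n (λ k → z *ᶜ monomial (coef e) z k)
      ≈⟨ +ᶜ-cong ≋-refl (∑<-*ˡ z n (monomial (coef e) z)) ⟩
    0ᶜ *ᶜ 1ᶜ +ᶜ z *ᶜ partialSum (coef e) z n
      ≈⟨ solve 1 (λ a → con 0ℚ :* con 1ℚ :+ a := a) ≋-refl (z *ᶜ partialSum (coef e) z n) ⟩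
    z *ᶜ partialSum (coef e) z n ∎

  -- The complex counterpart of `weightedSum-u`, now with the boundary term as an exact remainder.
  1-z*partialSum : ∀ f z n →
    (1ᶜ -ᶜ z) *ᶜ partialSum (λ k → ∑ℕ (suc k) f) z n ≋ partialSum f z n -ᶜ ℕ→ℂ (∑ℕ n f) *ᶜ z ^ᶜ n
  1-z*partialSum f z zero = begin
    (1ᶜ -ᶜ z) *ᶜ 0ᶜ          ≈⟨ solve 1 (λ z → (con 1ℚ :- z) :* con 0ℚ := con 0ℚ :- con 0ℚ :* con 1ℚ) ≋-refl z ⟩
    0ᶜ -ᶜ 0ᶜ *ᶜ 1ᶜ           ≈⟨ +ᶜ-cong ≋-refl (-ᶜ-cong (*ᶜ-cong ℕ→ℂ-zero ≋-refl)) ⟨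
    0ᶜ -ᶜ ℕ→ℂ 0 *ᶜ 1ᶜ        ∎
  1-z*partialSum f z (suc n) = begin
    (1ᶜ -ᶜ z) *ᶜ partialSum g z (suc n)
      ≈⟨ *ᶜ-cong ≋-refl (∑<-last n (monomial g z)) ⟩
    (1ᶜ -ᶜ z) *ᶜ (partialSum g z n +ᶜ ℕ→ℂ s *ᶜ w)
      ≈⟨ solve 4 (λ z p s w → (con 1ℚ :- z) :* (p :+ s :* w) := ((con 1ℚ :- z) :* p :+ s :* w) :- s :* (z :* w)) ≋-refl
           z (partialSum g z n) (ℕ→ℂ s) w ⟩
    ((1ᶜ -ᶜ z) *ᶜ partialSum g z n +ᶜ ℕ→ℂ s *ᶜ w) -ᶜ ℕ→ℂ s *ᶜ (z *ᶜ w)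
      ≈⟨ +ᶜ-cong (+ᶜ-cong (1-z*partialSum f z n) (*ᶜ-cong (ℕ→ℂ-+ (∑ℕ n f) (f n)) ≋-refl)) ≋-refl ⟩
    ((partialSum f z n -ᶜ ℕ→ℂ (∑ℕ n f) *ᶜ w) +ᶜ (ℕ→ℂ (∑ℕ n f) +ᶜ ℕ→ℂ (f n)) *ᶜ w) -ᶜ ℕ→ℂ s *ᶜ (z *ᶜ w)
      ≈⟨ solve 5 (λ p a b w t → ((p :- a :* w) :+ (a :+ b) :* w) :- t := (p :+ b :* w) :- t) ≋-refl
           (partialSum f z n) (ℕ→ℂ (∑ℕ n f)) (ℕ→ℂ (f n)) w (ℕ→ℂ s *ᶜ (z *ᶜ w)) ⟩
    (partialSum f z n +ᶜ ℕ→ℂ (f n) *ᶜ w) -ᶜ ℕ→ℂ s *ᶜ (z *ᶜ w)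
      ≈⟨ +ᶜ-cong (∑<-last n (monomial f z)) ≋-refl ⟨
    partialSum f z (suc n) -ᶜ ℕ→ℂ s *ᶜ z ^ᶜ suc n ∎
    where
    g : ℕ → ℕ
    g k = ∑ℕ (suc k) f
    s : ℕ
    s = ∑ℕ (suc n) f
    w : ℂ
    w = z ^ᶜ n

  partialSum-u : ∀ x f n → partialSum (λ k → ∑ℕ (suc k) f) (pt x) n
    ≋ (1/1- x) *ᶜ (partialSum f (pt x) n -ᶜ ℕ→ℂ (∑ℕ n f) *ᶜ pt x ^ᶜ n)
  partialSum-u x f n = begin
    P                                          ≈⟨ *ᶜ-identityˡ P ⟨
    1ᶜ *ᶜ P                                    ≈⟨ *ᶜ-cong (1-x-inverse x) ≋-refl ⟨
    ((1ᶜ -ᶜ pt x) *ᶜ (1/1- x)) *ᶜ P            ≈⟨ solve 3 (λ v u p → (v :* u) :* p := u :* (v :* p)) ≋-refl (1ᶜ -ᶜ pt x) (1/1- x) P ⟩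
    (1/1- x) *ᶜ ((1ᶜ -ᶜ pt x) *ᶜ P)            ≈⟨ *ᶜ-cong ≋-refl (1-z*partialSum f (pt x) n) ⟩
    (1/1- x) *ᶜ (partialSum f (pt x) n -ᶜ ℕ→ℂ (∑ℕ n f) *ᶜ pt x ^ᶜ n) ∎
    where
    P : ℂ
    P = partialSum (λ k → ∑ℕ (suc k) f) (pt x) n

  null-0 : Null (λ _ → 0ᶜ)
  null-0 = mkNull λ e 0<e → 0 , λ _ _ → ≲-mono (ℚₚ.<⇒≤ 0<e) (≲-ℚ→ℂ ℚₚ.≤-refl)

  -- Every clause except `u·` is algebra on the induction hypothesis. There `partialSum-u` leaves
  -- the boundary term with coefficient `∑ℕ n (coef e)`, which is at most the n-th coefficient of
  -- `u· e` itself.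
  expansion : ∀ e x → Null (λ n → partialSum (coef e) (pt x) n -ᶜ ⟦ e ⟧ x)
  expansion 𝟘 x = null-resp-≋ (λ n → ≋-sym (≋-trans (+ᶜ-cong (partialSum-zero (pt x) n) ≋-refl)
    (solve 0 (con 0ℚ :- con 0ℚ := con 0ℚ) ≋-refl))) null-0
  expansion 𝟙 x = null-unshift (null-resp-≋ (λ n → ≋-sym (≋-trans (+ᶜ-cong (partialSum-𝟙 (pt x) n) ≋-refl)
    (solve 0 (con 1ℚ :- con 1ℚ := con 0ℚ) ≋-refl))) null-0)
  expansion (x· e) x = null-unshift (null-resp-≋ (λ n → ≋-sym (≋-trans (+ᶜ-cong (partialSum-x e (pt x) n) ≋-refl)
    (solve 3 (λ z p s → z :* p :- z :* s := z :* (p :- s)) ≋-refl (pt x) (partialSum (coef e) (pt x) n) (⟦ e ⟧ x))))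
    (null-*ˡ (pt x) (expansion e x)))
  expansion (u· e) x = null-resp-≋ (λ n → ≋-sym (≋-trans (+ᶜ-cong (partialSum-u x (coef e) n) ≋-refl)
    (solve 4 (λ u p t s → u :* (p :- t) :- u :* s := u :* ((p :- s) :- t)) ≋-refl
      (1/1- x) (partialSum (coef e) (pt x) n) (ℕ→ℂ (∑ℕ n (coef e)) *ᶜ pt x ^ᶜ n) (⟦ e ⟧ x))))
    (null-*ˡ (1/1- x) (null-+ (expansion e x)
      (null-neg (null-dominated x (u· e) (λ n → ℕₚ.m≤m+n (∑ℕ n (coef e)) (coef e n))))))
  expansion (e ⊕ e′) x = null-resp-≋ (λ n → ≋-sym (≋-trans (+ᶜ-cong (partialSum-+ (coef e) (coef e′) (pt x) n) ≋-refl)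
    (solve 4 (λ p q s t → (p :+ q) :- (s :+ t) := (p :- s) :+ (q :- t)) ≋-refl
      (partialSum (coef e) (pt x) n) (partialSum (coef e′) (pt x) n) (⟦ e ⟧ x) (⟦ e′ ⟧ x))))
    (null-+ (expansion e x) (expansion e′ x))
  expansion (c ⊙ e) x = null-resp-≋ (λ n → ≋-sym (≋-trans (+ᶜ-cong (partialSum-* c (coef e) (pt x) n) ≋-refl)
    (solve 3 (λ c p s → c :* p :- c :* s := c :* (p :- s)) ≋-refl (ℕ→ℂ c) (partialSum (coef e) (pt x) n) (⟦ e ⟧ x))))
    (null-*ˡ (ℕ→ℂ c) (expansion e x))

-- Differentiation on the disc

-- A Taylor expansion with bounded quadratic remainder replaces the limit of difference quotients.
-- Sums and products then reduce to polynomial identities for the remainder `h`, without any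
-- division by y - x.
record DiffAt (f : Disc → ℂ) (x : Disc) (f′ : ℂ) : Set where
  constructor mkDiffAt
  field
    radius     : ℚ
    radius-pos : 0ℚ ℚ.< radius
    bound      : ℚ
    taylor     : ∀ y → pt y -ᶜ pt x ≲ radius → ∃[ h ] h ≲ bound ×
      f y ≋ f x +ᶜ (pt y -ᶜ pt x) *ᶜ f′ +ᶜ (pt y -ᶜ pt x) *ᶜ (pt y -ᶜ pt x) *ᶜ h

⊓-pos : ∀ {p q} → 0ℚ ℚ.< p → 0ℚ ℚ.< q → 0ℚ ℚ.< p ℚ.⊓ q
⊓-pos {p} {q} 0<p 0<q with ℚₚ.⊓-sel p q
... | inj₁ eq = subst (0ℚ ℚ.<_) (sym eq) 0<p
... | inj₂ eq = subst (0ℚ ℚ.<_) (sym eq) 0<q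

module _ where
  open ≋-Reasoning
  open ≋-Solver using (solve; _:=_; _:+_; _:*_; _:-_; con)

  diff-const : ∀ c x → DiffAt (λ _ → c) x 0ᶜ
  diff-const c x = mkDiffAt 1ℚ (ℚₚ.positive⁻¹ 1ℚ) 0ℚ λ y _ → 0ᶜ , ≲-ℚ→ℂ ℚₚ.≤-refl ,
    solve 2 (λ c d → c := c :+ d :* con 0ℚ :+ d :* d :* con 0ℚ) ≋-refl c (pt y -ᶜ pt x)

  diff-pt : ∀ x → DiffAt pt x 1ᶜ
  diff-pt x = mkDiffAt 1ℚ (ℚₚ.positive⁻¹ 1ℚ) 0ℚ λ y _ → 0ᶜ , ≲-ℚ→ℂ ℚₚ.≤-refl ,
    solve 2 (λ x y → y := x :+ (y :- x) :* con 1ℚ :+ (y :- x) :* (y :- x) :* con 0ℚ) ≋-refl (pt x) (pt y)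

  -- The resolvent identity, obtained by inserting (1 - x)u = 1 and (1 - y)v = 1. Substituted into
  -- itself it produces the quadratic remainder u u v.
  1/1--difference : ∀ x y → (1/1- y) ≋ (1/1- x) +ᶜ (pt y -ᶜ pt x) *ᶜ ((1/1- x) *ᶜ (1/1- y))
  1/1--difference x y = begin
    v                                                     ≈⟨ solve 2 (λ u v → v := u :* con 1ℚ :+ (con 1ℚ :* v :- u :* con 1ℚ)) ≋-refl u v ⟩
    u *ᶜ 1ᶜ +ᶜ (1ᶜ *ᶜ v -ᶜ u *ᶜ 1ᶜ)
      ≈⟨ +ᶜ-cong ≋-refl (+ᶜ-cong (*ᶜ-cong (1-x-inverse x) ≋-refl) (-ᶜ-cong (*ᶜ-cong ≋-refl (1-x-inverse y)))) ⟨
    u *ᶜ 1ᶜ +ᶜ (((1ᶜ -ᶜ pt x) *ᶜ u) *ᶜ v -ᶜ u *ᶜ ((1ᶜ -ᶜ pt y) *ᶜ v))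
      ≈⟨ solve 4 (λ u v x y → u :* con 1ℚ :+ (((con 1ℚ :- x) :* u) :* v :- u :* ((con 1ℚ :- y) :* v))
           := u :+ (y :- x) :* (u :* v)) ≋-refl u v (pt x) (pt y) ⟩
    u +ᶜ (pt y -ᶜ pt x) *ᶜ (u *ᶜ v)                       ∎
    where
    u v : ℂ
    u = 1/1- x
    v = 1/1- y

  -- The radius is half of 1 - ρ: then |y| ≤ ρ + δ < 1, and 1/(1 - y) is bounded independently of
  -- `y`.
  diff-1/1- : ∀ x → DiffAt (λ y → 1/1- y) x ((1/1- x) *ᶜ (1/1- x))
  diff-1/1- x =
    let ρ , ρ<1 , x≲ρ = disc-bound x
        B , _ , u≲B   = ≲-exists (1/1- x)
        δ             = ½ ℚ.* (1ℚ ℚ.- ρ)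
        0<σ           = subst (ℚ._< 1ℚ ℚ.- ρ) (ℚₚ.+-inverseʳ ρ) (ℚₚ.+-monoˡ-< (ℚ.- ρ) ρ<1)
        ρ+δ<1         = subst (ρ ℚ.+ δ ℚ.<_) (cancel ρ) (ℚₚ.+-monoʳ-< ρ (½-< 0<σ))
    in mkDiffAt δ (half-pos 0<σ) (B ℚ.* B ℚ.* recip (1ℚ ℚ.- (ρ ℚ.+ δ))) λ y d≲δ →
      let u = 1/1- x
          v = 1/1- y
          d = pt y -ᶜ pt x
          y≲ = ≲-resp-≋ (solve 2 (λ x y → x :+ (y :- x) := y) ≋-refl (pt x) (pt y)) (≲-+ x≲ρ d≲δ)
      in u *ᶜ u *ᶜ v
       , ≲-* (≲-* u≲B u≲B) (≲-recip-1- ρ+δ<1 y≲ (1-x-inverse y))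
       , (begin
           v                                  ≈⟨ 1/1--difference x y ⟩
           u +ᶜ d *ᶜ (u *ᶜ v)                 ≈⟨ +ᶜ-cong ≋-refl (*ᶜ-cong ≋-refl (*ᶜ-cong ≋-refl (1/1--difference x y))) ⟩
           u +ᶜ d *ᶜ (u *ᶜ (u +ᶜ d *ᶜ (u *ᶜ v)))
             ≈⟨ solve 3 (λ u v d → u :+ d :* (u :* (u :+ d :* (u :* v))) := u :+ d :* (u :* u) :+ d :* d :* (u :* u :* v)) ≋-refl u v d ⟩
           u +ᶜ d *ᶜ (u *ᶜ u) +ᶜ d *ᶜ d *ᶜ (u *ᶜ u *ᶜ v) ∎)
    where
    cancel : ∀ ρ → ρ ℚ.+ (1ℚ ℚ.- ρ) ≡ 1ℚ
    cancel = solve′ 1 (λ r → r ⊹ (con′ 1ℚ ⊹ ⊖ r) ≔ con′ 1ℚ) refl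
      where open ℚSolver.+-*-Solver using () renaming (solve to solve′; _:=_ to _≔_; _:+_ to _⊹_; :-_ to ⊖_; con to con′)

  diff-+ : ∀ {f g x f′ g′} → DiffAt f x f′ → DiffAt g x g′ → DiffAt (λ y → f y +ᶜ g y) x (f′ +ᶜ g′)
  diff-+ {f} {g} {x} {f′} {g′} (mkDiffAt r 0<r M tf) (mkDiffAt s 0<s N tg) =
    mkDiffAt (r ℚ.⊓ s) (⊓-pos 0<r 0<s) (M ℚ.+ N) λ y d≲ →
      let h , h≲M , fy = tf y (≲-mono (ℚₚ.p⊓q≤p r s) d≲)
          k , k≲N , gy = tg y (≲-mono (ℚₚ.p⊓q≤q r s) d≲)
      in h +ᶜ k , ≲-+ h≲M k≲N , ≋-trans (+ᶜ-cong fy gy)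
        (solve 7 (λ f g f′ g′ d h k → (f :+ d :* f′ :+ d :* d :* h) :+ (g :+ d :* g′ :+ d :* d :* k)
          := (f :+ g) :+ d :* (f′ :+ g′) :+ d :* d :* (h :+ k)) ≋-refl (f x) (g x) f′ g′ (pt y -ᶜ pt x) h k)

  diff-* : ∀ {f g x f′ g′} → DiffAt f x f′ → DiffAt g x g′ →
    DiffAt (λ y → f y *ᶜ g y) x (f′ *ᶜ g x +ᶜ f x *ᶜ g′)
  diff-* {f} {g} {x} {f′} {g′} (mkDiffAt r 0<r M tf) (mkDiffAt s 0<s N tg) =
    let F  , _ , f≲  = ≲-exists (f x)
        G  , _ , g≲  = ≲-exists (g x)
        F′ , _ , f′≲ = ≲-exists f′
        G′ , _ , g′≲ = ≲-exists g′
        t = r ℚ.⊓ s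
    in mkDiffAt t (⊓-pos 0<r 0<s)
      -- The remainder collects the terms of the product of degree at least 2 in d, divided by d²;
      -- the bound follows it summand by summand, with `t` in place of d.
      (F ℚ.* N ℚ.+ M ℚ.* G ℚ.+ F′ ℚ.* G′ ℚ.+ t ℚ.* (F′ ℚ.* N ℚ.+ M ℚ.* G′) ℚ.+ t ℚ.* t ℚ.* (M ℚ.* N)) λ y d≲ →
      let h , h≲M , fy = tf y (≲-mono (ℚₚ.p⊓q≤p r s) d≲)
          k , k≲N , gy = tg y (≲-mono (ℚₚ.p⊓q≤q r s) d≲)
          d = pt y -ᶜ pt x
      in f x *ᶜ k +ᶜ h *ᶜ g x +ᶜ f′ *ᶜ g′ +ᶜ d *ᶜ (f′ *ᶜ k +ᶜ h *ᶜ g′) +ᶜ d *ᶜ d *ᶜ (h *ᶜ k)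
       , ≲-+ (≲-+ (≲-+ (≲-+ (≲-* f≲ k≲N) (≲-* h≲M g≲)) (≲-* f′≲ g′≲))
           (≲-* d≲ (≲-+ (≲-* f′≲ k≲N) (≲-* h≲M g′≲)))) (≲-* (≲-* d≲ d≲) (≲-* h≲M k≲N))
       , ≋-trans (*ᶜ-cong fy gy)
        (solve 7 (λ f g f′ g′ d h k → (f :+ d :* f′ :+ d :* d :* h) :* (g :+ d :* g′ :+ d :* d :* k)
          := (f :* g) :+ d :* (f′ :* g :+ f :* g′) :+ d :* d :*
             (f :* k :+ h :* g :+ f′ :* g′ :+ d :* (f′ :* k :+ h :* g′) :+ d :* d :* (h :* k))) ≋-refl
          (f x) (g x) f′ g′ d h k)

  diff-resp-≋ : ∀ {f g x f′ g′} → (∀ y → f y ≋ g y) → f′ ≋ g′ → DiffAt f x f′ → DiffAt g x g′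
  diff-resp-≋ {x = x} f≋g f′≋g′ (mkDiffAt r 0<r M t) = mkDiffAt r 0<r M λ y d≲ →
    let h , h≲ , eq = t y d≲ in
    h , h≲ , ≋-trans (≋-sym (f≋g y)) (≋-trans eq (+ᶜ-cong (+ᶜ-cong (f≋g x) (*ᶜ-cong ≋-refl f′≋g′)) ≋-refl))

  diff-Term : ∀ e x → DiffAt ⟦ e ⟧ x (⟦ ∂ e ⟧ x)
  diff-Term 𝟘        x = diff-const 0ᶜ x
  diff-Term 𝟙        x = diff-const 1ᶜ x
  diff-Term (x· e)   x = diff-resp-≋ (λ _ → ≋-refl)
    (+ᶜ-cong (*ᶜ-identityˡ (⟦ e ⟧ x)) ≋-refl) (diff-* (diff-pt x) (diff-Term e x))
  diff-Term (u· e)   x = diff-resp-≋ (λ _ → ≋-refl)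
    (solve 3 (λ u e e′ → (u :* u) :* e :+ u :* e′ := u :* (u :* e) :+ u :* e′) ≋-refl (1/1- x) (⟦ e ⟧ x) (⟦ ∂ e ⟧ x))
    (diff-* (diff-1/1- x) (diff-Term e x))
  diff-Term (e ⊕ e′) x = diff-+ (diff-Term e x) (diff-Term e′ x)
  diff-Term (c ⊙ e)  x = diff-resp-≋ (λ _ → ≋-refl)
    (solve 3 (λ c e e′ → con 0ℚ :* e :+ c :* e′ := c :* e′) ≋-refl (ℕ→ℂ c) (⟦ e ⟧ x) (⟦ ∂ e ⟧ x))
    (diff-* (diff-const (ℕ→ℂ c) x) (diff-Term e x))

  -- With `r` the inverse of `d`, the error of the difference quotient is exactly d h, hence small
  -- with d.
  difference-quotient : ∀ {a b d r g h} → d *ᶜ r ≋ 1ᶜ → b ≋ a +ᶜ d *ᶜ g +ᶜ d *ᶜ d *ᶜ h →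
    d *ᶜ h ≋ (b -ᶜ a) *ᶜ r -ᶜ g
  difference-quotient {a} {b} {d} {r} {g} {h} dr≋1 b≋ = ≋-sym (begin
    (b -ᶜ a) *ᶜ r -ᶜ g
      ≈⟨ +ᶜ-cong (*ᶜ-cong (+ᶜ-cong b≋ ≋-refl) ≋-refl) ≋-refl ⟩
    ((a +ᶜ d *ᶜ g +ᶜ d *ᶜ d *ᶜ h) -ᶜ a) *ᶜ r -ᶜ g
      ≈⟨ solve 5 (λ a d r g h → ((a :+ d :* g :+ d :* d :* h) :- a) :* r :- g := (d :* r) :* (g :+ d :* h) :- g) ≋-refl a d r g h ⟩
    (d *ᶜ r) *ᶜ (g +ᶜ d *ᶜ h) -ᶜ g
      ≈⟨ +ᶜ-cong (*ᶜ-cong dr≋1 ≋-refl) ≋-refl ⟩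
    1ᶜ *ᶜ (g +ᶜ d *ᶜ h) -ᶜ g
      ≈⟨ solve 2 (λ g t → con 1ℚ :* (g :+ t) :- g := t) ≋-refl g (d *ᶜ h) ⟩
    d *ᶜ h ∎)

diffAt⇒isDerivative : ∀ {f f′} → (∀ x → DiffAt f x (f′ x)) → IsDerivative f f′
diffAt⇒isDerivative {f} {f′} diff x ε 0<ε =
  let mkDiffAt r 0<r M taylor = diff x
      e , 0<e , e≤ε = positive-lower-bound {ε} 0<ε
      -- The field `bound` has no recorded sign, and `recip` needs a positive argument. The radius
      -- `t` then makes the error at most e/2, strictly below e.
      N   = ℚ.∣ M ∣ ℚ.+ 1ℚ
      0<N = ℚₚ.+-mono-≤-< (ℚₚ.0≤∣p∣ M) (ℚₚ.positive⁻¹ 1ℚ)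
      M≤N = ℚₚ.≤-trans (p≤∣p∣ M) (p≤p+q ℚ.∣ M ∣ (ℚₚ.<⇒≤ (ℚₚ.positive⁻¹ 1ℚ)))
      t   = recip N ℚ.* (½ ℚ.* e)
      δ   = r ℚ.⊓ t
      0<δ = ⊓-pos 0<r (*-pos (recip-pos 0<N) (half-pos 0<e))
  in ℚ→ℝ δ , (δ , 0<δ , 0 , λ _ _ → ℚₚ.≤-reflexive (ℚₚ.+-identityˡ δ)) , λ y y#x d<δ →
  let d = pt y -ᶜ pt x
      p , p<δ , d≲p = ∣∣ᶜ<⇒≲ {d} d<δ
      d≲δ = ≲-mono (ℚₚ.<⇒≤ p<δ) d≲p
      h , h≲M , eq = taylor y (≲-mono (ℚₚ.p⊓q≤p r t) d≲δ)
      dh≲ = subst (d *ᶜ h ≲_) (trans (ℚₚ.*-comm t N) (*-recip-cancel 0<N (½ ℚ.* e)))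
              (≲-* (≲-mono (ℚₚ.p⊓q≤q r t) d≲δ) (≲-mono M≤N h≲M))
  in ≲⇒∣∣ᶜ< {ε = ε} (½-< 0<e) e≤ε (≲-resp-≋ (difference-quotient (*ᶜ-inverseʳ d y#x) eq) dh≲)

-- The first derivative is taken innermost, matching the recursion of `IsIteratedDerivative`.
∂^ : ℕ → Term → Term
∂^ zero    e = e
∂^ (suc r) e = ∂^ r (∂ e)

-- The function to be differentiated agrees with a term only up to `_≋_`; from its first derivative
-- on, the functions are literally values of terms.
isIteratedDerivative-Term : ∀ r {f} e → (∀ y → f y ≋ ⟦ e ⟧ y) → IsIteratedDerivative r f ⟦ ∂^ r e ⟧
isIteratedDerivative-Term zero    e f≋e x = ≋⇒≈ᶜ (f≋e x)
isIteratedDerivative-Term (suc r) e f≋e = ⟦ ∂ e ⟧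
  , diffAt⇒isDerivative (λ x → diff-resp-≋ (λ y → ≋-sym (f≋e y)) ≋-refl (diff-Term e x))
  , isIteratedDerivative-Term r (∂ e) (λ _ → ≋-refl)

-- Coefficients of the geometric series

infixr 8 x·^ u·^
x·^ u·^ : ℕ → Term → Term
x·^ zero    e = e
x·^ (suc j) e = x· x·^ j e
u·^ zero    e = e
u·^ (suc m) e = u· u·^ m e

∑ᵀ : ℕ → (ℕ → Term) → Term
∑ᵀ zero    t = 𝟘
∑ᵀ (suc n) t = ∑ᵀ n t ⊕ t n

coef-∑ᵀ : ∀ n t k → coef (∑ᵀ n t) k ≡ ∑ℕ n (λ j → coef (t j) k)
coef-∑ᵀ zero    t k = refl
coef-∑ᵀ (suc n) t k = cong (_+ coef (t n) k) (coef-∑ᵀ n t k)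

coef-x·^ : ∀ j e i → coef (x·^ j e) (j + i) ≡ coef e i
coef-x·^ zero    e i = refl
coef-x·^ (suc j) e i = coef-x·^ j e i

coef-x·^-< : ∀ {j k} e → k < j → coef (x·^ j e) k ≡ 0
coef-x·^-< {suc j} {zero}  e _         = refl
coef-x·^-< {suc j} {suc k} e (s≤s k<j) = coef-x·^-< e k<j

-- Splitting off the last summand of the partial sum formed by `u·` leaves Pascal's rule.
coef-u·^ : ∀ m k → coef (u·^ (suc m) 𝟙) k ≡ (m + k) C k
coef-u·^ zero    zero    = refl
coef-u·^ zero    (suc k) = trans (trans (ℕₚ.+-identityʳ _) (coef-u·^ zero k)) (trans (nCn≡1 k) (sym (nCn≡1 (suc k))))
coef-u·^ (suc m) zero    = coef-u·^ m zero
coef-u·^ (suc m) (suc k) = begin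
  coef (u·^ (suc (suc m)) 𝟙) k + coef (u·^ (suc m) 𝟙) (suc k)
    ≡⟨ cong₂ _+_ (coef-u·^ (suc m) k) (coef-u·^ m (suc k)) ⟩
  suc (m + k) C k + (m + suc k) C suc k
    ≡⟨ cong (λ n → n C k + (m + suc k) C suc k) (ℕₚ.+-suc m k) ⟨
  (m + suc k) C k + (m + suc k) C suc k
    ≡⟨ nCk+nC[k+1]≡[n+1]C[k+1] (m + suc k) k ⟩
  suc (m + suc k) C suc k ∎
  where open ≡-Reasoning

C-! : ∀ m k → ((m + k) C k) * (m ! * k !) ≡ (m + k) !
C-! m k = begin
  ((m + k) C k) * (m ! * k !)
    ≡⟨ cong (((m + k) C k) *_) (trans (ℕₚ.*-comm (m !) (k !)) (cong (λ n → k ! * n !) (sym (ℕₚ.m+n∸n≡m m k)))) ⟩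
  ((m + k) C k) * D
    ≡⟨ cong (_* D) (nCk≡n!/k![n-k]! k≤m+k) ⟩
  ((m + k) ! / D) * D
    ≡⟨ m/n*n≡m (k![n∸k]!∣n! k≤m+k) ⟩
  (m + k) ! ∎
  where
  open ≡-Reasoning
  k≤m+k : k ≤ m + k
  k≤m+k = ℕₚ.m≤n+m k m
  D : ℕ
  D = k ! * (m + k ∸ k) !
  instance
    D≢0 : NonZero D
    D≢0 = k ℕₚ.!* (m + k ∸ k) !≢0

-- Falling factorials and the Stirling expansion of powers

fallingFactorial : ℕ → ℕ → ℕ
fallingFactorial n       zero    = 1
fallingFactorial zero    (suc j) = 0
fallingFactorial (suc n) (suc j) = suc n * fallingFactorial n j

fallingFactorial-! : ∀ j i → fallingFactorial (j + i) j * i ! ≡ (j + i) !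
fallingFactorial-! zero    i = ℕₚ.*-identityˡ (i !)
fallingFactorial-! (suc j) i = trans (ℕₚ.*-assoc (suc (j + i)) (fallingFactorial (j + i) j) (i !))
  (cong (suc (j + i) *_) (fallingFactorial-! j i))

fallingFactorial-< : ∀ {n j} → n < j → fallingFactorial n j ≡ 0
fallingFactorial-< {zero}  {suc j} _         = refl
fallingFactorial-< {suc n} {suc j} (s≤s n<j) =
  trans (cong (suc n *_) (fallingFactorial-< n<j)) (ℕₚ.*-zeroʳ (suc n))

S-< : ∀ {n k} → n < k → S n k ≡ 0
S-< {zero}  {suc k} _         = refl
S-< {suc n} {suc k} (s≤s n<k) = cong₂ _+_
  (trans (cong (suc k *_) (S-< (ℕₚ.m<n⇒m<1+n n<k))) (ℕₚ.*-zeroʳ (suc k))) (S-< n<k)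

∑ℕ-*ˡ : ∀ c n f → ∑ℕ n (λ k → c * f k) ≡ c * ∑ℕ n f
∑ℕ-*ˡ c zero    f = sym (ℕₚ.*-zeroʳ c)
∑ℕ-*ˡ c (suc n) f = trans (cong (_+ c * f n) (∑ℕ-*ˡ c n f)) (sym (ℕₚ.*-distribˡ-+ c (∑ℕ n f) (f n)))

module _ where
  open ℕSolver.+-*-Solver using (solve; _:=_; _:+_; _:*_; con)
  open ≡-Reasoning

  -- Writing (n)_j for the falling factorial, this is (n)_(j+1) = (n - j)(n)_j with the subtraction
  -- moved across, so that it holds for j > n as well.
  *-fallingFactorial : ∀ n j → n * fallingFactorial n j ≡ fallingFactorial n (suc j) + j * fallingFactorial n j
  *-fallingFactorial zero    zero    = refl
  *-fallingFactorial zero    (suc j) = sym (ℕₚ.*-zeroʳ (suc j))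
  *-fallingFactorial (suc n) zero    = sym (ℕₚ.+-identityʳ (suc n * 1))
  *-fallingFactorial (suc n) (suc j) = begin
    suc n * (suc n * a)
      ≡⟨ solve 2 (λ n a → (con 1 :+ n) :* ((con 1 :+ n) :* a) := (con 1 :+ n) :* (n :* a :+ a)) refl n a ⟩
    suc n * (n * a + a)
      ≡⟨ cong (λ z → suc n * (z + a)) (*-fallingFactorial n j) ⟩
    suc n * (b + j * a + a)
      ≡⟨ solve 4 (λ n j a b → (con 1 :+ n) :* (b :+ j :* a :+ a) := (con 1 :+ n) :* b :+ (con 1 :+ j) :* ((con 1 :+ n) :* a)) refl n j a b ⟩
    suc n * b + suc j * (suc n * a) ∎
    where
    a b : ℕ
    a = fallingFactorial n j
    b = fallingFactorial n (suc j)

  -- The recurrence of `S` and `*-fallingFactorial` match up summand by summand, except at the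
  -- cut-off. The last term is this defect; at m = p + 1 it vanishes because S(p, p+1) = 0.
  ∑ℕ-S-step : ∀ n p m → ∑ℕ (suc m) (λ j → S (suc p) j * fallingFactorial n j)
    ≡ n * ∑ℕ m (λ j → S p j * fallingFactorial n j) + m * (S p m * fallingFactorial n m)
  ∑ℕ-S-step n p zero    = sym (trans (ℕₚ.+-identityʳ (n * 0)) (ℕₚ.*-zeroʳ n))
  ∑ℕ-S-step n p (suc m) = begin
    ∑ℕ (suc m) (λ j → S (suc p) j * fallingFactorial n j) + (suc m * s′ + s) * f′
      ≡⟨ cong (_+ (suc m * s′ + s) * f′) (∑ℕ-S-step n p m) ⟩
    n * q + m * (s * f) + (suc m * s′ + s) * f′
      ≡⟨ solve 7 (λ n q m s s′ f f′ → n :* q :+ m :* (s :* f) :+ ((con 1 :+ m) :* s′ :+ s) :* f′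
           := n :* q :+ s :* (f′ :+ m :* f) :+ (con 1 :+ m) :* (s′ :* f′)) refl n q m s s′ f f′ ⟩
    n * q + s * (f′ + m * f) + suc m * (s′ * f′)
      ≡⟨ cong (λ z → n * q + s * z + suc m * (s′ * f′)) (*-fallingFactorial n m) ⟨
    n * q + s * (n * f) + suc m * (s′ * f′)
      ≡⟨ solve 5 (λ n q s f t → n :* q :+ s :* (n :* f) :+ t := n :* (q :+ s :* f) :+ t) refl n q s f (suc m * (s′ * f′)) ⟩
    n * (q + s * f) + suc m * (s′ * f′) ∎
    where
    q s s′ f f′ : ℕ
    q  = ∑ℕ m (λ j → S p j * fallingFactorial n j)
    s  = S p m
    s′ = S p (suc m)
    f  = fallingFactorial n m
    f′ = fallingFactorial n (suc m)

  ∑ℕ-S : ∀ n p → ∑ℕ (suc p) (λ j → S p j * fallingFactorial n j) ≡ n ^ p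
  ∑ℕ-S n zero    = refl
  ∑ℕ-S n (suc p) = begin
    ∑ℕ (suc (suc p)) (λ j → S (suc p) j * fallingFactorial n j)
      ≡⟨ ∑ℕ-S-step n p (suc p) ⟩
    n * ∑ℕ (suc p) (λ j → S p j * fallingFactorial n j) + suc p * (S p (suc p) * fallingFactorial n (suc p))
      ≡⟨ cong₂ (λ a b → n * a + suc p * (b * fallingFactorial n (suc p))) (∑ℕ-S n p) (S-< (ℕₚ.n<1+n p)) ⟩
    n * n ^ p + suc p * 0
      ≡⟨ trans (cong (n * n ^ p +_) (ℕₚ.*-zeroʳ (suc p))) (ℕₚ.+-identityʳ (n * n ^ p)) ⟩
    n ^ suc p ∎

  -- Power series of the geometric polynomials

  -- This is u^(r+1) (x u)^j, regrouped so that its coefficients are a shift of those of a power of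
  -- u.
  geometricTerm : ℕ → ℕ → Term
  geometricTerm r j = x·^ j (u·^ (suc (j + r)) 𝟙)

  -- For k < j both sides vanish. For k = j + i both become (r + k)! after multiplication by i!.
  coef-geometricTerm : ∀ r j k → (j + r) ! * coef (geometricTerm r j) k ≡ (r ! * ((r + k) C k)) * fallingFactorial k j
  coef-geometricTerm r j k with ℕₚ.<-≤-connex k j
  ... | inj₁ k<j = trans
    (trans (cong ((j + r) ! *_) (coef-x·^-< (u·^ (suc (j + r)) 𝟙) k<j)) (ℕₚ.*-zeroʳ ((j + r) !)))
    (sym (trans (cong (r ! * ((r + k) C k) *_) (fallingFactorial-< k<j)) (ℕₚ.*-zeroʳ (r ! * ((r + k) C k)))))
  ... | inj₂ j≤k = subst (λ k → (j + r) ! * coef (geometricTerm r j) k ≡ (r ! * ((r + k) C k)) * fallingFactorial k j)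
    (ℕₚ.m+[n∸m]≡n j≤k) (at (k ∸ j))
    where
    at : ∀ i → (j + r) ! * coef (geometricTerm r j) (j + i) ≡ (r ! * ((r + (j + i)) C (j + i))) * fallingFactorial (j + i) j
    at i = ℕₚ.*-cancelʳ-≡ _ _ (i !) {{i ℕₚ.!≢0}} (begin
      (j + r) ! * coef (geometricTerm r j) (j + i) * i !
        ≡⟨ cong (λ z → (j + r) ! * z * i !) (trans (coef-x·^ j (u·^ (suc (j + r)) 𝟙) i) (coef-u·^ (j + r) i)) ⟩
      (j + r) ! * ((j + r + i) C i) * i !
        ≡⟨ solve 3 (λ a b c → a :* b :* c := b :* (a :* c)) refl ((j + r) !) ((j + r + i) C i) (i !) ⟩
      ((j + r + i) C i) * ((j + r) ! * i !)
        ≡⟨ C-! (j + r) i ⟩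
      (j + r + i) !
        ≡⟨ cong _! (solve 3 (λ a b c → a :+ b :+ c := b :+ (a :+ c)) refl j r i) ⟩
      (r + (j + i)) !
        ≡⟨ C-! r (j + i) ⟨
      ((r + (j + i)) C (j + i)) * (r ! * (j + i) !)
        ≡⟨ cong (λ z → ((r + (j + i)) C (j + i)) * (r ! * z)) (fallingFactorial-! j i) ⟨
      ((r + (j + i)) C (j + i)) * (r ! * (fallingFactorial (j + i) j * i !))
        ≡⟨ solve 4 (λ a b c d → a :* (b :* (c :* d)) := (b :* a) :* c :* d) refl
             ((r + (j + i)) C (j + i)) (r !) (fallingFactorial (j + i) j) (i !) ⟩
      (r ! * ((r + (j + i)) C (j + i))) * fallingFactorial (j + i) j * i ! ∎)

  -- Its value is r! u^(r+1) ω_(p,r+1)(x u), as scalars of terms are natural numbers. For r = 0 it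
  -- is u ω_p(x u).
  geometricSum : ℕ → ℕ → Term
  geometricSum p r = ∑ᵀ (suc p) (λ j → (S p j * (j + r) !) ⊙ geometricTerm r j)

  coef-geometricSum : ∀ p r k → coef (geometricSum p r) k ≡ r ! * (((r + k) C k) * k ^ p)
  coef-geometricSum p r k = begin
    coef (geometricSum p r) k
      ≡⟨ coef-∑ᵀ (suc p) (λ j → (S p j * (j + r) !) ⊙ geometricTerm r j) k ⟩
    ∑ℕ (suc p) (λ j → S p j * (j + r) ! * coef (geometricTerm r j) k)
      ≡⟨ ∑ℕ-cong (suc p) (λ j → trans (ℕₚ.*-assoc (S p j) ((j + r) !) (coef (geometricTerm r j) k))
           (trans (cong (S p j *_) (coef-geometricTerm r j k))
             (solve 3 (λ a b c → a :* (b :* c) := b :* (a :* c)) refl (S p j) (r ! * ((r + k) C k)) (fallingFactorial k j)))) ⟩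
    ∑ℕ (suc p) (λ j → (r ! * ((r + k) C k)) * (S p j * fallingFactorial k j))
      ≡⟨ ∑ℕ-*ˡ (r ! * ((r + k) C k)) (suc p) (λ j → S p j * fallingFactorial k j) ⟩
    (r ! * ((r + k) C k)) * ∑ℕ (suc p) (λ j → S p j * fallingFactorial k j)
      ≡⟨ cong ((r ! * ((r + k) C k)) *_) (∑ℕ-S k p) ⟩
    (r ! * ((r + k) C k)) * k ^ p
      ≡⟨ ℕₚ.*-assoc (r !) ((r + k) C k) (k ^ p) ⟩
    r ! * (((r + k) C k) * k ^ p) ∎

  coef-u·geometricSum : ∀ p k → coef (u· geometricSum p 0) k ≡ ∑ℕ (suc k) (_^ p)
  coef-u·geometricSum p k = ∑ℕ-cong (suc k) (λ n → trans (coef-geometricSum p 0 n)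
    (trans (cong (λ z → 1 * (z * n ^ p)) (nCn≡1 n)) (solve 1 (λ a → con 1 :* (con 1 :* a) := a) refl (n ^ p))))

  coef-∂^ : ∀ r e n → coef (∂^ r e) n * n ! ≡ (n + r) ! * coef e (n + r)
  coef-∂^ zero    e n = trans (ℕₚ.*-comm (coef e n) (n !)) (cong (λ m → m ! * coef e m) (sym (ℕₚ.+-identityʳ n)))
  coef-∂^ (suc r) e n = begin
    coef (∂^ r (∂ e)) n * n !                           ≡⟨ coef-∂^ r (∂ e) n ⟩
    (n + r) ! * coef (∂ e) (n + r)                      ≡⟨ cong ((n + r) ! *_) (coef-∂ e (n + r)) ⟩
    (n + r) ! * (suc (n + r) * coef e (suc (n + r)))    ≡⟨ solve 3 (λ a b c → a :* (b :* c) := (b :* a) :* c) refl ((n + r) !) (suc (n + r)) (coef e (suc (n + r))) ⟩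
    suc (n + r) ! * coef e (suc (n + r))                ≡⟨ cong (λ m → m ! * coef e m) (ℕₚ.+-suc n r) ⟨
    (n + suc r) ! * coef e (n + suc r)                  ∎

  -- The factor x^r undoes the index shift of r derivatives, leaving the factor (r + n)!/n! = r!
  -- C(r+n,n).
  coef-∂^-x·^ : ∀ r e n → coef (∂^ r (x·^ r e)) n ≡ r ! * (((r + n) C n) * coef e n)
  coef-∂^-x·^ r e n = ℕₚ.*-cancelʳ-≡ _ _ (n !) {{n ℕₚ.!≢0}} (begin
    coef (∂^ r (x·^ r e)) n * n !                 ≡⟨ coef-∂^ r (x·^ r e) n ⟩
    (n + r) ! * coef (x·^ r e) (n + r)            ≡⟨ cong (λ m → m ! * coef (x·^ r e) m) (ℕₚ.+-comm n r) ⟩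
    (r + n) ! * coef (x·^ r e) (r + n)            ≡⟨ cong₂ _*_ (sym (C-! r n)) (coef-x·^ r e n) ⟩
    ((r + n) C n) * (r ! * n !) * coef e n          ≡⟨ solve 4 (λ a b c d → a :* (b :* c) :* d := b :* (a :* d) :* c) refl ((r + n) C n) (r !) (n !) (coef e n) ⟩
    r ! * (((r + n) C n) * coef e n) * n !          ∎)

-- Summation of the weighted tails

1/!-inverse : ∀ r → (1/ r !ᶜ) *ᶜ ℕ→ℂ (r !) ≋ 1ᶜ
1/!-inverse r = ≋-trans (≋-sym (ℚ→ℂ-* _ (fromℕ (r !)))) (≋-reflexive (cong ℚ→ℂ (inverse (r !) {{r ℕₚ.!≢0}})))
  where
  inverse : ∀ m .{{_ : NonZero m}} → (ℤ.+ 1 ℚ./ m) ℚ.* fromℕ m ≡ 1ℚ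
  inverse (suc m) = trans (cong (ℚ._* fromℕ (suc m)) (sym (unit-def m)))
    (trans (ℚₚ.*-comm (unit m) (fromℕ (suc m))) (unit-inverse m))

module _ where
  open ≋-Reasoning
  open ≋-Solver using (solve; _:=_; _:+_; _:*_; _:-_; con)

  ⟦∑ᵀ⟧ : ∀ n t y → ⟦ ∑ᵀ n t ⟧ y ≋ ∑< n (λ k → ⟦ t k ⟧ y)
  ⟦∑ᵀ⟧ zero    t y = ≋-refl
  ⟦∑ᵀ⟧ (suc n) t y = ≋-trans (+ᶜ-cong (⟦∑ᵀ⟧ n t y) ≋-refl) (≋-sym (∑<-last n (λ k → ⟦ t k ⟧ y)))

  ⟦x·^⟧ : ∀ j e y → ⟦ x·^ j e ⟧ y ≋ pt y ^ᶜ j *ᶜ ⟦ e ⟧ y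
  ⟦x·^⟧ zero    e y = ≋-sym (*ᶜ-identityˡ (⟦ e ⟧ y))
  ⟦x·^⟧ (suc j) e y = ≋-trans (*ᶜ-cong ≋-refl (⟦x·^⟧ j e y))
    (solve 3 (λ a b c → a :* (b :* c) := (a :* b) :* c) ≋-refl (pt y) (pt y ^ᶜ j) (⟦ e ⟧ y))

  ⟦u·^𝟙⟧ : ∀ m y → ⟦ u·^ m 𝟙 ⟧ y ≋ (1/1- y) ^ᶜ m
  ⟦u·^𝟙⟧ zero    y = ≋-refl
  ⟦u·^𝟙⟧ (suc m) y = *ᶜ-cong ≋-refl (⟦u·^𝟙⟧ m y)

  ^ᶜ-regroup : ∀ z w j m → z ^ᶜ j *ᶜ w ^ᶜ suc (j + m) ≋ w ^ᶜ suc m *ᶜ (z *ᶜ w) ^ᶜ j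
  ^ᶜ-regroup z w zero    m = solve 1 (λ a → con 1ℚ :* a := a :* con 1ℚ) ≋-refl (w ^ᶜ suc m)
  ^ᶜ-regroup z w (suc j) m = begin
    (z *ᶜ z ^ᶜ j) *ᶜ (w *ᶜ w ^ᶜ suc (j + m))
      ≈⟨ solve 4 (λ z a w b → (z :* a) :* (w :* b) := (z :* w) :* (a :* b)) ≋-refl z (z ^ᶜ j) w (w ^ᶜ suc (j + m)) ⟩
    (z *ᶜ w) *ᶜ (z ^ᶜ j *ᶜ w ^ᶜ suc (j + m))
      ≈⟨ *ᶜ-cong ≋-refl (^ᶜ-regroup z w j m) ⟩
    (z *ᶜ w) *ᶜ (w ^ᶜ suc m *ᶜ (z *ᶜ w) ^ᶜ j)
      ≈⟨ solve 3 (λ a b c → a :* (b :* c) := b :* (a :* c)) ≋-refl (z *ᶜ w) (w ^ᶜ suc m) ((z *ᶜ w) ^ᶜ j) ⟩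
    w ^ᶜ suc m *ᶜ ((z *ᶜ w) *ᶜ (z *ᶜ w) ^ᶜ j) ∎

  ⟦geometricSum⟧ : ∀ p r y → ⟦ geometricSum p r ⟧ y
    ≋ (1/1- y) ^ᶜ suc r *ᶜ ∑≤ p (λ k → ℕ→ℂ (S p k * (k + r) !) *ᶜ (pt y *ᶜ (1/1- y)) ^ᶜ k)
  ⟦geometricSum⟧ p r y = begin
    ⟦ geometricSum p r ⟧ y
      ≈⟨ ⟦∑ᵀ⟧ (suc p) (λ j → (S p j * (j + r) !) ⊙ geometricTerm r j) y ⟩
    ∑≤ p (λ k → c k *ᶜ ⟦ geometricTerm r k ⟧ y)
      ≈⟨ ∑<-cong (suc p) (λ k → ≋-trans
           (*ᶜ-cong ≋-refl (≋-trans (⟦x·^⟧ k (u·^ (suc (k + r)) 𝟙) y)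
             (≋-trans (*ᶜ-cong ≋-refl (⟦u·^𝟙⟧ (suc (k + r)) y)) (^ᶜ-regroup (pt y) u k r))))
           (solve 3 (λ a b c → a :* (b :* c) := b :* (a :* c)) ≋-refl (c k) (u ^ᶜ suc r) ((pt y *ᶜ u) ^ᶜ k))) ⟩
    ∑≤ p (λ k → u ^ᶜ suc r *ᶜ (c k *ᶜ (pt y *ᶜ u) ^ᶜ k))
      ≈⟨ ∑<-*ˡ (u ^ᶜ suc r) (suc p) (λ k → c k *ᶜ (pt y *ᶜ u) ^ᶜ k) ⟩
    u ^ᶜ suc r *ᶜ ∑≤ p (λ k → c k *ᶜ (pt y *ᶜ u) ^ᶜ k) ∎
    where
    u : ℂ
    u = 1/1- y
    c : ℕ → ℂ
    c k = ℕ→ℂ (S p k * (k + r) !)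

  ⟦geometricSum⟧-ωGen : ∀ p r y → (1/ r !ᶜ) *ᶜ ⟦ geometricSum p r ⟧ y
    ≋ (1/1- y) ^ᶜ suc r *ᶜ ωGen p r (pt y *ᶜ (1/1- y))
  ⟦geometricSum⟧-ωGen p r y = ≋-trans (*ᶜ-cong ≋-refl (⟦geometricSum⟧ p r y))
    (solve 3 (λ a b c → a :* (b :* c) := b :* (a :* c)) ≋-refl (1/ r !ᶜ) ((1/1- y) ^ᶜ suc r)
      (∑≤ p (λ k → ℕ→ℂ (S p k * (k + r) !) *ᶜ (pt y *ᶜ (1/1- y)) ^ᶜ k)))

  -- One factor of u² is already in `geometricSum p 0`, whose coefficients are the k^p; the other
  -- turns these into the power sums B_(k+1).
  differentiatedTerm : ℕ → ℕ → Term
  differentiatedTerm p r = x·^ r (u· geometricSum p 0)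

  ∑≤-ω : ∀ p z → ∑≤ p (λ k → ℕ→ℂ (S p k * (k + 0) !) *ᶜ z ^ᶜ k) ≋ ω p z
  ∑≤-ω p z = ∑<-cong (suc p) {g = λ k → ℕ→ℂ (S p k * k !) *ᶜ z ^ᶜ k}
    (λ k → ≋-reflexive (cong (λ n → ℕ→ℂ (S p k * n !) *ᶜ z ^ᶜ k) (ℕₚ.+-identityʳ k)))

  ⟦x·^u·⟧ : ∀ r e y {s} → ⟦ e ⟧ y ≋ (1/1- y) ^ᶜ 1 *ᶜ s → ⟦ x·^ r (u· e) ⟧ y ≋ (pt y ^ᶜ r *ᶜ (1/1- y) ^ᶜ 2) *ᶜ s
  ⟦x·^u·⟧ r e y {s} eq = ≋-trans (⟦x·^⟧ r (u· e) y) (≋-trans (*ᶜ-cong ≋-refl (*ᶜ-cong ≋-refl eq))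
    (solve 4 (λ a u v w → a :* (u :* (v :* w)) := (a :* (u :* v)) :* w) ≋-refl (pt y ^ᶜ r) (1/1- y) ((1/1- y) ^ᶜ 1) s))

  ⟦differentiatedTerm⟧ : ∀ p r y → (pt y ^ᶜ r *ᶜ (1/1- y) ^ᶜ 2) *ᶜ ω p (pt y *ᶜ (1/1- y))
    ≋ ⟦ differentiatedTerm p r ⟧ y
  ⟦differentiatedTerm⟧ p r y = ≋-sym (⟦x·^u·⟧ r (geometricSum p 0) y
    (≋-trans (⟦geometricSum⟧ p 0 y) (*ᶜ-cong ≋-refl (∑≤-ω p (pt y *ᶜ (1/1- y))))))

  coef-∂^-differentiatedTerm : ∀ p r n →
    coef (∂^ r (differentiatedTerm p r)) n ≡ r ! * (((r + n) C n) * ∑ℕ (suc n) (_^ p))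
  coef-∂^-differentiatedTerm p r n = trans (coef-∂^-x·^ r (u· geometricSum p 0) n)
    (cong (λ z → r ! * (((r + n) C n) * z)) (coef-u·geometricSum p n))

  -- Multiplication by 1/r! preserves null sequences, so the factor r! forced by natural scalars is
  -- removed after passing to the limit.
  rescaled-expansion : ∀ r e f x → (∀ k → coef e k ≡ r ! * f k) →
    Null (λ n → partialSum f (pt x) n -ᶜ (1/ r !ᶜ) *ᶜ ⟦ e ⟧ x)
  rescaled-expansion r e f x eq = null-resp-≋ (λ n → begin
    (1/ r !ᶜ) *ᶜ (partialSum (coef e) (pt x) n -ᶜ ⟦ e ⟧ x)
      ≈⟨ *ᶜ-cong ≋-refl (+ᶜ-cong (≋-trans (partialSum-cong n (pt x) eq) (partialSum-* (r !) f (pt x) n)) ≋-refl) ⟩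
    (1/ r !ᶜ) *ᶜ (ℕ→ℂ (r !) *ᶜ partialSum f (pt x) n -ᶜ ⟦ e ⟧ x)
      ≈⟨ solve 4 (λ a b p s → a :* (b :* p :- s) := (a :* b) :* p :- a :* s) ≋-refl (1/ r !ᶜ) (ℕ→ℂ (r !)) (partialSum f (pt x) n) (⟦ e ⟧ x) ⟩
    ((1/ r !ᶜ) *ᶜ ℕ→ℂ (r !)) *ᶜ partialSum f (pt x) n -ᶜ (1/ r !ᶜ) *ᶜ ⟦ e ⟧ x
      ≈⟨ +ᶜ-cong (≋-trans (*ᶜ-cong (1/!-inverse r) ≋-refl) (*ᶜ-identityˡ (partialSum f (pt x) n))) ≋-refl ⟩
    partialSum f (pt x) n -ᶜ (1/ r !ᶜ) *ᶜ ⟦ e ⟧ x ∎) (null-*ˡ (1/ r !ᶜ) (expansion e x))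

  tail : ℕ → Disc → ℕ → ℂ
  tail m x n = (1/1- x) ^ᶜ m -ᶜ partialSum (coef (u·^ m 𝟙)) (pt x) (suc n)

  -- The boundary term of `partialSum-u` has as coefficient the sum of the coefficients of u^m up to
  -- degree n, which is the n-th coefficient of u^(m+1).
  tail-suc : ∀ m x n → tail (suc m) x n
    ≋ (1/1- x) *ᶜ tail m x n +ᶜ (1/1- x) *ᶜ (pt x *ᶜ monomial (coef (u·^ (suc m) 𝟙)) (pt x) n)
  tail-suc m x n = ≋-trans (+ᶜ-cong ≋-refl (-ᶜ-cong (partialSum-u x (coef (u·^ m 𝟙)) (suc n))))
    (solve 6 (λ u v p c z w → u :* v :- u :* (p :- c :* (z :* w)) := u :* (v :- p) :+ u :* (z :* (c :* w))) ≋-refl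
      (1/1- x) ((1/1- x) ^ᶜ m) (partialSum (coef (u·^ m 𝟙)) (pt x) (suc n))
      (ℕ→ℂ (coef (u·^ (suc m) 𝟙) n)) (pt x) (pt x ^ᶜ n))

  -- Each use of `tail-suc` lowers the exponent and leaves a weighted monomial, until the tail of
  -- u^0 = 1 is zero. The hypothesis ranges over all `m` because every smaller power contributes one
  -- monomial.
  null-tail : ∀ (g : ℕ → ℕ) x → (∀ m → Null (monomial (λ n → g n * coef (u·^ (suc m) 𝟙) n) (pt x))) →
    ∀ m → Null (λ n → ℕ→ℂ (g n) *ᶜ tail m x n)
  null-tail g x null zero    = null-resp-≋ (λ n → ≋-sym (≋-trans
    (*ᶜ-cong ≋-refl (+ᶜ-cong ≋-refl (-ᶜ-cong (partialSum-𝟙 (pt x) n))))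
    (solve 1 (λ a → a :* (con 1ℚ :- con 1ℚ) := con 0ℚ) ≋-refl (ℕ→ℂ (g n))))) null-0
  null-tail g x null (suc m) = null-resp-≋ (λ n → ≋-sym (begin
    ℕ→ℂ (g n) *ᶜ tail (suc m) x n
      ≈⟨ *ᶜ-cong ≋-refl (tail-suc m x n) ⟩
    ℕ→ℂ (g n) *ᶜ ((1/1- x) *ᶜ tail m x n +ᶜ (1/1- x) *ᶜ (pt x *ᶜ (ℕ→ℂ (c n) *ᶜ pt x ^ᶜ n)))
      ≈⟨ solve 6 (λ g u t z c w → g :* (u :* t :+ u :* (z :* (c :* w))) := u :* (g :* t) :+ u :* (z :* ((g :* c) :* w))) ≋-refl
           (ℕ→ℂ (g n)) (1/1- x) (tail m x n) (pt x) (ℕ→ℂ (c n)) (pt x ^ᶜ n) ⟩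
    (1/1- x) *ᶜ (ℕ→ℂ (g n) *ᶜ tail m x n) +ᶜ (1/1- x) *ᶜ (pt x *ᶜ ((ℕ→ℂ (g n) *ᶜ ℕ→ℂ (c n)) *ᶜ pt x ^ᶜ n))
      ≈⟨ +ᶜ-cong ≋-refl (*ᶜ-cong ≋-refl (*ᶜ-cong ≋-refl (*ᶜ-cong (ℕ→ℂ-* (g n) (c n)) ≋-refl))) ⟨
    (1/1- x) *ᶜ (ℕ→ℂ (g n) *ᶜ tail m x n) +ᶜ (1/1- x) *ᶜ (pt x *ᶜ monomial (λ n → g n * c n) (pt x) n) ∎))
    (null-+ (null-*ˡ (1/1- x) (null-tail g x null m)) (null-*ˡ (1/1- x) (null-*ˡ (pt x) (null m))))
    where
    c : ℕ → ℕ
    c = coef (u·^ (suc m) 𝟙)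

  -- From n to n + 1 the tail on the right loses its monomial of degree n + 1; multiplied by
  -- `∑ℕ (suc n) b`, this is the new summand of the partial sum. The offset is harmless at n = 0,
  -- where the only summand has weight `∑ℕ 0 b`, that is 0.
  abel-summation : ∀ b c s z n →
    ∑< n (λ k → ℕ→ℂ (b k) *ᶜ (s -ᶜ partialSum c z (suc k)))
    ≋ ℕ→ℂ (∑ℕ n b) *ᶜ (s -ᶜ partialSum c z (suc n)) +ᶜ partialSum (λ k → c k * ∑ℕ k b) z (suc n)
  abel-summation b c s z zero = ≋-sym (begin
    ℕ→ℂ 0 *ᶜ t +ᶜ (ℕ→ℂ (c 0 * 0) *ᶜ 1ᶜ +ᶜ 0ᶜ)
      ≈⟨ +ᶜ-cong (*ᶜ-cong ℕ→ℂ-zero ≋-refl) (+ᶜ-cong (*ᶜ-cong (≋-trans (ℕ→ℂ-* (c 0) 0) (*ᶜ-cong ≋-refl ℕ→ℂ-zero)) ≋-refl) ≋-refl) ⟩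
    0ᶜ *ᶜ t +ᶜ ((ℕ→ℂ (c 0) *ᶜ 0ᶜ) *ᶜ 1ᶜ +ᶜ 0ᶜ)
      ≈⟨ solve 2 (λ t c → con 0ℚ :* t :+ ((c :* con 0ℚ) :* con 1ℚ :+ con 0ℚ) := con 0ℚ) ≋-refl t (ℕ→ℂ (c 0)) ⟩
    0ᶜ ∎)
    where
    t : ℂ
    t = s -ᶜ partialSum c z 1
  abel-summation b c s z (suc n) = begin
    ∑< (suc n) (λ k → ℕ→ℂ (b k) *ᶜ (s -ᶜ partialSum c z (suc k)))
      ≈⟨ ∑<-last n (λ k → ℕ→ℂ (b k) *ᶜ (s -ᶜ partialSum c z (suc k))) ⟩
    ∑< n (λ k → ℕ→ℂ (b k) *ᶜ (s -ᶜ partialSum c z (suc k))) +ᶜ ℕ→ℂ (b n) *ᶜ (s -ᶜ P)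
      ≈⟨ +ᶜ-cong (abel-summation b c s z n) ≋-refl ⟩
    (ℕ→ℂ (∑ℕ n b) *ᶜ (s -ᶜ P) +ᶜ Q) +ᶜ ℕ→ℂ (b n) *ᶜ (s -ᶜ P)
      ≈⟨ solve 7 (λ B β s P Q c w → (B :* (s :- P) :+ Q) :+ β :* (s :- P)
           := (B :+ β) :* (s :- (P :+ c :* w)) :+ (Q :+ (c :* (B :+ β)) :* w)) ≋-refl
           (ℕ→ℂ (∑ℕ n b)) (ℕ→ℂ (b n)) s P Q (ℕ→ℂ (c (suc n))) (z ^ᶜ suc n) ⟩
    (ℕ→ℂ (∑ℕ n b) +ᶜ ℕ→ℂ (b n)) *ᶜ (s -ᶜ (P +ᶜ monomial c z (suc n)))
      +ᶜ (Q +ᶜ (ℕ→ℂ (c (suc n)) *ᶜ (ℕ→ℂ (∑ℕ n b) +ᶜ ℕ→ℂ (b n))) *ᶜ z ^ᶜ suc n)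
      ≈⟨ +ᶜ-cong (*ᶜ-cong (ℕ→ℂ-+ (∑ℕ n b) (b n)) (+ᶜ-cong ≋-refl (-ᶜ-cong (∑<-last (suc n) (monomial c z)))))
           (≋-trans (∑<-last (suc n) (monomial f z)) (+ᶜ-cong ≋-refl
             (*ᶜ-cong (≋-trans (ℕ→ℂ-* (c (suc n)) (∑ℕ (suc n) b)) (*ᶜ-cong ≋-refl (ℕ→ℂ-+ (∑ℕ n b) (b n)))) ≋-refl))) ⟨
    ℕ→ℂ (∑ℕ (suc n) b) *ᶜ (s -ᶜ partialSum c z (suc (suc n))) +ᶜ partialSum f z (suc (suc n)) ∎
    where
    f : ℕ → ℕ
    f k = c k * ∑ℕ k b
    P Q : ℂ
    P = partialSum c z (suc n)
    Q = partialSum f z (suc n)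

  weightedTails : ℕ → ℕ → Disc → ℕ → ℂ
  weightedTails r p x n = ℕ→ℂ (n ^ p) *ᶜ ((1/1- x) ^ᶜ suc r -ᶜ ∑≤ n (λ k → ℕ→ℂ ((r + k) C k) *ᶜ pt x ^ᶜ k))

  weightedTails-null : ∀ r p x → Null (λ n → ∑< n (weightedTails r p x)
    -ᶜ ((1/ r !ᶜ) *ᶜ ⟦ ∂^ r (differentiatedTerm p r) ⟧ x -ᶜ (1/1- x) ^ᶜ suc r *ᶜ ωGen p r (pt x *ᶜ (1/1- x))))
  weightedTails-null r p x = null-resp-≋ (λ n → ≋-sym (begin
    ∑< n (weightedTails r p x) -ᶜ (d -ᶜ w)
      ≈⟨ +ᶜ-cong (abel-summation (_^ p) c U z n) ≋-refl ⟩
    (ℕ→ℂ (B n) *ᶜ (U -ᶜ partialSum c z (suc n)) +ᶜ partialSum cB z (suc n)) -ᶜ (d -ᶜ w)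
      -- The partial sum for `cK` is added and subtracted: `cB` plus `cK` is `cA`, the coefficients
      -- belonging to `d`, and `cK` alone belongs to `w`.
      ≈⟨ solve 5 (λ t q k d w → (t :+ q) :- (d :- w) := t :+ (((q :+ k) :- d) :- (k :- w))) ≋-refl
           (ℕ→ℂ (B n) *ᶜ (U -ᶜ partialSum c z (suc n))) (partialSum cB z (suc n)) (partialSum cK z (suc n)) d w ⟩
    ℕ→ℂ (B n) *ᶜ (U -ᶜ partialSum c z (suc n))
      +ᶜ (((partialSum cB z (suc n) +ᶜ partialSum cK z (suc n)) -ᶜ d) -ᶜ (partialSum cK z (suc n) -ᶜ w))
      ≈⟨ +ᶜ-cong (*ᶜ-cong ≋-refl (+ᶜ-cong ≋-refl (-ᶜ-cong (partialSum-cong (suc n) z (coef-u·^ r)))))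
           (+ᶜ-cong (+ᶜ-cong (≋-trans (partialSum-cong (suc n) z (λ k → ℕₚ.*-distribˡ-+ (c k) (B k) (k ^ p)))
             (partialSum-+ cB cK z (suc n))) ≋-refl)
             (-ᶜ-cong (+ᶜ-cong ≋-refl (-ᶜ-cong (⟦geometricSum⟧-ωGen p r x))))) ⟨
    ℕ→ℂ (B n) *ᶜ tail (suc r) x n
      +ᶜ ((partialSum cA z (suc n) -ᶜ d) -ᶜ (partialSum cK z (suc n) -ᶜ (1/ r !ᶜ) *ᶜ ⟦ geometricSum p r ⟧ x)) ∎))
    (null-+ (null-tail B x (λ m → null-dominated x (∂^ m (differentiatedTerm p m)) (dominated m)) (suc r))
      (null-+ (null-shift (rescaled-expansion r (∂^ r (differentiatedTerm p r)) cA x (coef-∂^-differentiatedTerm p r)))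
        (null-neg (null-shift (rescaled-expansion r (geometricSum p r) cK x (coef-geometricSum p r))))))
    where
    z U d w : ℂ
    z = pt x
    U = (1/1- x) ^ᶜ suc r
    d = (1/ r !ᶜ) *ᶜ ⟦ ∂^ r (differentiatedTerm p r) ⟧ x
    w = U *ᶜ ωGen p r (pt x *ᶜ (1/1- x))
    c B cA cB cK : ℕ → ℕ
    c k  = (r + k) C k
    B k  = ∑ℕ k (_^ p)
    cA k = c k * B (suc k)
    cB k = c k * B k
    cK k = c k * k ^ p
    -- With `m` in the role of r, the coefficient on the right is m! C(m+n,n) B(n+1), which exceeds
    -- the left side because B(n) ≤ B(n+1) and m! ≥ 1.
    dominated : ∀ m n → B n * coef (u·^ (suc m) 𝟙) n ≤ coef (∂^ m (differentiatedTerm p m)) n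
    dominated m n = subst₂ _≤_
      (trans (ℕₚ.*-comm ((m + n) C n) (B n)) (cong (B n *_) (sym (coef-u·^ m n))))
      (sym (coef-∂^-differentiatedTerm p m n))
      (ℕₚ.≤-trans (ℕₚ.*-monoʳ-≤ ((m + n) C n) (ℕₚ.m≤m+n (B n) (n ^ p)))
        (ℕₚ.m≤n*m (((m + n) C n) * B (suc n)) (m !) {{m ℕₚ.!≢0}}))

corollary4 : ∀ (r p : ℕ) → 0 < p → ∀ (x : Disc) →
    Σ[ d ∈ ℂ ]
    HasIteratedDerivativeAt r
    (λ y → (pt y ^ᶜ r *ᶜ (1/1- y) ^ᶜ 2) *ᶜ ω p (pt y *ᶜ (1/1- y))) x d
    × HasSum
    (λ n → ℕ→ℂ (n ^ p) *ᶜ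
    ((1/1- x) ^ᶜ suc r -ᶜ ∑≤ n (λ k → ℕ→ℂ ((r + k) C k) *ᶜ pt x ^ᶜ k)))
    (1/ r !ᶜ *ᶜ d
    -ᶜ (1/1- x) ^ᶜ suc r *ᶜ ωGen p r (pt x *ᶜ (1/1- x)))
corollary4 r p _ x = ⟦ ∂^ r e ⟧ x
  , (⟦ ∂^ r e ⟧ , isIteratedDerivative-Term r e (⟦differentiatedTerm⟧ p r) , ≋⇒≈ᶜ (≋-refl {⟦ ∂^ r e ⟧ x}))
  , null⇒hasSum {weightedTails r p x} (weightedTails-null r p x)
  where
  e : Term
  e = differentiatedTerm p r
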